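{- Let $f:\mathbb N\to\mathbb N$ be a computable function. Then there is a class $\mathcal C$ of finite graphs and a first-order sentence $\varphi$ of vocabulary $\{E\}$ such that (i) $\mathcal C=\mathrm{Graph}_{\mathrm{fin}}(\varphi)$; (ii) $\mathcal C=\mathrm{Graph}_{\mathrm{fin}}(\mu)$ for some universal sentence $\mu$ (in particular $\mathcal C$ is closed under induced subgraphs); (iii) for every universal sentence $\mu$ with $\mathcal C=\mathrm{Graph}_{\mathrm{fin}}(\mu)$ we have $|\mu|\ge f(|\varphi|)$.
   Context: Graphs are $\{E\}$-structures with $E$ binary, irreflexive and symmetric. $\mathrm{Graph}_{\mathrm{fin}}(\varphi)$ is the class of finite graphs that are models of $\varphi$. A first-order formula is universal if it is built from atomic and negated atomic formulas using $\wedge$, $\vee$ and $\forall$. $|\varphi|$ denotes the length (number of symbols) of the formula $\varphi$. -}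

module Defs where

open import Data.Nat using (ℕ; zero; suc; _+_; _<_; _≥_)
open import Data.Fin using (Fin)
open import Data.Vec using (Vec; []; _∷_; lookup)
open import Data.Bool using (Bool; true; false; T)
open import Data.Product using (Σ; _×_)
open import Data.Sum using (_⊎_)
open import Data.Empty using (⊥)
open import Data.Unit using (⊤)
open import Relation.Nullary using (¬_)
open import Relation.Binary.PropositionalEquality using (_≡_)

data PR : ℕ → Set where
  zer  : ∀ {k} → PR k
  succ : PR 1
  proj : ∀ {k} → Fin k → PR k
  comp : ∀ {k m} → PR m → Vec (PR k) m → PR k
  prec : ∀ {k} → PR k → PR (suc (suc k)) → PR (suc k)
  mini : ∀ {k} → PR (suc k) → PR k

mutual
  data Eval : ∀ {k} → PR k → Vec ℕ k → ℕ → Set where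
    ev-zer  : ∀ {k} {xs : Vec ℕ k} → Eval zer xs 0
    ev-succ : ∀ {x} → Eval succ (x ∷ []) (suc x)
    ev-proj : ∀ {k} {i : Fin k} {xs} → Eval (proj i) xs (lookup xs i)
    ev-comp : ∀ {k m} {g : PR m} {hs : Vec (PR k) m} {xs ys y} →
              EvalVec hs xs ys → Eval g ys y → Eval (comp g hs) xs y
    ev-prec0 : ∀ {k} {g : PR k} {h} {xs y} →
               Eval g xs y → Eval (prec g h) (0 ∷ xs) y
    ev-precS : ∀ {k} {g : PR k} {h} {n xs y z} →
               Eval (prec g h) (n ∷ xs) y → Eval h (n ∷ y ∷ xs) z →
               Eval (prec g h) (suc n ∷ xs) z
    ev-mini : ∀ {k} {f : PR (suc k)} {xs n} →
              Eval f (n ∷ xs) 0 →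
              (∀ m → m < n → Σ ℕ (λ y → Eval f (m ∷ xs) (suc y))) →
              Eval (mini f) xs n

  data EvalVec {k} : ∀ {m} → Vec (PR k) m → Vec ℕ k → Vec ℕ m → Set where
    []  : ∀ {xs} → EvalVec [] xs []
    _∷_ : ∀ {m} {h} {hs : Vec (PR k) m} {xs y ys} →
          Eval h xs y → EvalVec hs xs ys → EvalVec (h ∷ hs) xs (y ∷ ys)

Computable : (ℕ → ℕ) → Set
Computable f = Σ (PR 1) λ c → ∀ n → Eval c (n ∷ []) (f n)

record FinGraph : Set where
  field
    size  : ℕ
    adj   : Fin size → Fin size → Bool
    irrefl : ∀ x → adj x x ≡ false
    sym    : ∀ x y → adj x y ≡ adj y x
open FinGraph public

data Formula : ℕ → Set where
  _≐_  : ∀ {k} → Fin k → Fin k → Formula k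
  E    : ∀ {k} → Fin k → Fin k → Formula k
  ¬'   : ∀ {k} → Formula k → Formula k
  _∧'_ : ∀ {k} → Formula k → Formula k → Formula k
  _∨'_ : ∀ {k} → Formula k → Formula k → Formula k
  ∀'   : ∀ {k} → Formula (suc k) → Formula k
  ∃'   : ∀ {k} → Formula (suc k) → Formula k

Sentence : Set
Sentence = Formula 0

-- Length = number of symbols: x = y and E x y have 3 symbols,
-- ¬φ adds 1, (φ ∧ ψ) and (φ ∨ ψ) add 3 (two brackets, connective),
-- ∀x φ and ∃x φ add 2 (quantifier, variable).
len : ∀ {k} → Formula k → ℕ
len (x ≐ y)   = 3
len (E x y)   = 3
len (¬' φ)    = suc (len φ)
len (φ ∧' ψ)  = 3 + len φ + len ψ
len (φ ∨' ψ)  = 3 + len φ + len ψ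
len (∀' φ)    = 2 + len φ
len (∃' φ)    = 2 + len φ

data IsAtomic {k} : Formula k → Set where
  at-eq : ∀ x y → IsAtomic (x ≐ y)
  at-E  : ∀ x y → IsAtomic (E x y)

data IsUniversal : ∀ {k} → Formula k → Set where
  u-atom : ∀ {k} {φ : Formula k} → IsAtomic φ → IsUniversal φ
  u-neg  : ∀ {k} {φ : Formula k} → IsAtomic φ → IsUniversal (¬' φ)
  u-∧    : ∀ {k} {φ ψ : Formula k} → IsUniversal φ → IsUniversal ψ → IsUniversal (φ ∧' ψ)
  u-∨    : ∀ {k} {φ ψ : Formula k} → IsUniversal φ → IsUniversal ψ → IsUniversal (φ ∨' ψ)
  u-∀    : ∀ {k} {φ : Formula (suc k)} → IsUniversal φ → IsUniversal (∀' φ)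

Sat : (G : FinGraph) → ∀ {k} → Formula k → Vec (Fin (size G)) k → Set
Sat G (x ≐ y)  ρ = lookup ρ x ≡ lookup ρ y
Sat G (E x y)  ρ = T (adj G (lookup ρ x) (lookup ρ y))
Sat G (¬' φ)   ρ = ¬ Sat G φ ρ
Sat G (φ ∧' ψ) ρ = Sat G φ ρ × Sat G ψ ρ
Sat G (φ ∨' ψ) ρ = Sat G φ ρ ⊎ Sat G ψ ρ
Sat G (∀' φ)   ρ = ∀ a → Sat G φ (a ∷ ρ)
Sat G (∃' φ)   ρ = Σ (Fin (size G)) λ a → Sat G φ (a ∷ ρ)

_⊨_ : FinGraph → Sentence → Set
G ⊨ φ = Sat G φ []

_≡Graphfin_ : (FinGraph → Set) → Sentence → Set
C ≡Graphfin φ = ∀ G → (C G → G ⊨ φ) × (G ⊨ φ → C G)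

{-# OPTIONS --safe #-}
module Submission where

-- Numbers 0,…,M are coded in a graph by triples of vertices (a, b, c), recognized by their
-- adjacencies to three parameters, such that bᵢ ~ cⱼ codes i ≤ j, cᵢ ~ aⱼ codes j = i + 1 and
-- aᵢ ~ bⱼ (i < j) codes that the i-th binary digit of j is 1.  A universal sentence says that the
-- coded numbers are linearly ordered and that nothing lies between a number and its successor.
-- In a graph satisfying it, an interval closed under successors stays an interval in every larger
-- such graph, so "some interval codes {0,…,M} with its binary digits, and M satisfies ψ" is
-- preserved upwards; hence the graphs satisfying the universal sentence but not this statement
-- are closed under induced subgraphs.  Order and binary digits give bounded set theory, so ψ can
-- say that the computation of f at a tower 2^2^…^2 of height j fits below M.  Restricting to a
-- fixed M that is big enough bounds the minimal forbidden graphs, which yields a universal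
-- axiomatization; on the other hand M is at least the value of f, so every graph that is
-- forbidden because of ψ has at least that many vertices, and a universal sentence excluding it
-- must be as long.  The sentence for j has length linear in j, so for some j it can be padded to
-- have length exactly 2^2^…^2.

open import Defs renaming (sym to adj-sym)
open import Data.Bool using (Bool; true; false; T; T?; _≟_; _∨_; not)
open import Data.Bool.Properties using (T-∨; ∨-comm; ∨-identityʳ)
open import Data.Empty using (⊥; ⊥-elim)
open import Data.Fin as Fin using (Fin; zero; suc; toℕ; _↑ˡ_; _↑ʳ_)
open import Data.Fin.Patterns using (0F; 1F; 2F; 3F; 4F; 5F; 6F; 7F; 8F)
import Data.Fin.Properties as Finₚ
open import Data.List as List using (List; []; _∷_; length)
open import Data.List.Membership.Propositional using (_∈_)
open import Data.List.Membership.Propositional.Properties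
  using (∈-++⁺ˡ; ∈-++⁺ʳ; ∈-map⁺; ∈-map⁻)
open import Data.List.Properties using (length-++)
open import Data.List.Relation.Unary.Any using (here; there)
open import Data.Nat as ℕ
  using (ℕ; zero; suc; _+_; _*_; _∸_; _^_; _⊔_; _⊓_; _≤_; _<_; _≥_; z≤n; s≤s; _≡ᵇ_; _≤ᵇ_)
import Data.Nat.Properties as ℕₚ
open import Data.Nat.Solver using (module +-*-Solver)
open import Data.Product as Product using (Σ; ∃; ∃₂; _×_; _,_; proj₁; proj₂)
open import Data.Product.Properties using (≡-dec)
open import Data.List.Membership.DecPropositional (≡-dec ℕₚ._≟_ ℕₚ._≟_) using (_∈?_)
open import Data.Sum as Sum using (_⊎_; inj₁; inj₂)
open import Data.Unit using (⊤; tt)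
open import Data.Vec using (Vec; []; _∷_; lookup; tabulate; _++_)
open import Data.Vec.Functional using () renaming (_∷_ to infixr 5 _◂_)
open import Data.Vec.Properties using (lookup∘tabulate; lookup-++ˡ; lookup-++ʳ)
open import Function using (_∘_; id; _⇔_; mk⇔; Equivalence)
open import Relation.Binary.Definitions using (tri<; tri≈; tri>)
open import Relation.Binary.PropositionalEquality
  using (_≡_; refl; sym; trans; cong; cong₂; subst; subst₂; module ≡-Reasoning)
open import Relation.Nullary using (¬_; Dec; yes; no)
open import Relation.Nullary.Decidable
  using (_×-dec_; _⊎-dec_; _→-dec_; ¬?; decidable-stable; from-yes)

open Equivalence using (to; from)


-- Embeddings, universal formulas and witnesses of their failure.

Vertex : FinGraph → Set
Vertex G = Fin (size G)

sat? : ∀ G {k} (φ : Formula k) ρ → Dec (Sat G φ ρ)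
sat? G (x ≐ y)  ρ = lookup ρ x Finₚ.≟ lookup ρ y
sat? G (E x y)  ρ = T? _
sat? G (¬' φ)   ρ = ¬? (sat? G φ ρ)
sat? G (φ ∧' ψ) ρ = sat? G φ ρ ×-dec sat? G ψ ρ
sat? G (φ ∨' ψ) ρ = sat? G φ ρ ⊎-dec sat? G ψ ρ
sat? G (∀' φ)   ρ = Finₚ.all? λ a → sat? G φ (a ∷ ρ)
sat? G (∃' φ)   ρ = Finₚ.any? λ a → sat? G φ (a ∷ ρ)

record _↪_ (H G : FinGraph) : Set where
  field
    fn       : Vertex H → Vertex G
    fn-inj   : ∀ {x y} → fn x ≡ fn y → x ≡ y
    fn-adj   : ∀ x y → adj H x y ≡ adj G (fn x) (fn y)
open _↪_ public

Hits : ∀ {H G} → H ↪ G → Vertex G → Set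
Hits ι v = ∃ λ x → fn ι x ≡ v

_CoveredBy_ : ∀ {H G} → List (Vertex G) → H ↪ G → Set
L CoveredBy ι = ∀ {v} → v ∈ L → Hits ι v

HereditaryClass : (FinGraph → Set) → Set
HereditaryClass C = ∀ {H G} → H ↪ G → C G → C H

-- Univ differs from IsUniversal in admitting arbitrary negations below the quantifiers.

QF : ∀ {k} → Formula k → Set
QF (x ≐ y)  = ⊤
QF (E x y)  = ⊤
QF (¬' φ)   = QF φ
QF (φ ∧' ψ) = QF φ × QF ψ
QF (φ ∨' ψ) = QF φ × QF ψ
QF (∀' φ)   = ⊥
QF (∃' φ)   = ⊥

data Univ : ∀ {k} → Formula k → Set where
  qf  : ∀ {k} {φ : Formula k} → QF φ → Univ φ
  and : ∀ {k} {φ ψ : Formula k} → Univ φ → Univ ψ → Univ (φ ∧' ψ)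
  or  : ∀ {k} {φ ψ : Formula k} → Univ φ → Univ ψ → Univ (φ ∨' ψ)
  all : ∀ {k} {φ : Formula (suc k)} → Univ φ → Univ (∀' φ)

IsUniversal⇒Univ : ∀ {k} {φ : Formula k} → IsUniversal φ → Univ φ
IsUniversal⇒Univ (u-atom (at-eq x y)) = qf tt
IsUniversal⇒Univ (u-atom (at-E x y))  = qf tt
IsUniversal⇒Univ (u-neg (at-eq x y))  = qf tt
IsUniversal⇒Univ (u-neg (at-E x y))   = qf tt
IsUniversal⇒Univ (u-∧ p q)            = and (IsUniversal⇒Univ p) (IsUniversal⇒Univ q)
IsUniversal⇒Univ (u-∨ p q)            = or (IsUniversal⇒Univ p) (IsUniversal⇒Univ q)
IsUniversal⇒Univ (u-∀ p)              = all (IsUniversal⇒Univ p)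

record Along {H G k} (ι : H ↪ G) (σ : Vec (Vertex H) k) (ρ : Vec (Vertex G) k) : Set where
  constructor along
  field at : ∀ i → fn ι (lookup σ i) ≡ lookup ρ i
open Along

along-∷ : ∀ {H G k} (ι : H ↪ G) {σ : Vec _ k} {ρ a b} →
          fn ι a ≡ b → Along ι σ ρ → Along ι (a ∷ σ) (b ∷ ρ)
along-∷ ι p q .at zero    = p
along-∷ ι p q .at (suc i) = q .at i

qf-invariant : ∀ {H G k} (ι : H ↪ G) (φ : Formula k) → QF φ → ∀ {σ ρ} → Along ι σ ρ →
               Sat H φ σ ⇔ Sat G φ ρ
qf-invariant ι (x ≐ y) _ p = mk⇔
  (λ e → trans (sym (p .at x)) (trans (cong (fn ι) e) (p .at y)))
  (λ e → fn-inj ι (trans (p .at x) (trans e (sym (p .at y)))))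
qf-invariant {G = G} ι (E x y) _ {σ} p = mk⇔ (subst T e) (subst T (sym e))
  where e = trans (fn-adj ι (lookup σ x) (lookup σ y)) (cong₂ (adj G) (p .at x) (p .at y))
qf-invariant ι (¬' φ) q p =
  let e = qf-invariant ι φ q p in mk⇔ (_∘ from e) (_∘ to e)
qf-invariant ι (φ ∧' ψ) (q , r) p =
  let e = qf-invariant ι φ q p ; f = qf-invariant ι ψ r p in
  mk⇔ (λ (a , b) → to e a , to f b) (λ (a , b) → from e a , from f b)
qf-invariant ι (φ ∨' ψ) (q , r) p =
  let e = qf-invariant ι φ q p ; f = qf-invariant ι ψ r p in
  mk⇔ (Sum.map (to e) (to f)) (Sum.map (from e) (from f))

univ-hereditary : ∀ {H G k} (ι : H ↪ G) {φ : Formula k} → Univ φ → ∀ {σ ρ} → Along ι σ ρ →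
                  Sat G φ ρ → Sat H φ σ
univ-hereditary ι {φ} (qf q) p s = from (qf-invariant ι φ q p) s
univ-hereditary ι (and u v) p (s , t) = univ-hereditary ι u p s , univ-hereditary ι v p t
univ-hereditary ι (or u v) p (inj₁ s) = inj₁ (univ-hereditary ι u p s)
univ-hereditary ι (or u v) p (inj₂ s) = inj₂ (univ-hereditary ι v p s)
univ-hereditary ι (all u) p s a = univ-hereditary ι u (along-∷ ι refl p) (s (fn ι a))

-- Quantifying over all subgraphs that contain L makes such certificates monotone in L, so that they
-- can be united.
Refutes : ∀ {k} → Formula k → (G : FinGraph) → Vec (Vertex G) k → List (Vertex G) → Set
Refutes φ G ρ L = ∀ {H} (ι : H ↪ G) → L CoveredBy ι → ∀ {σ} → Along ι σ ρ → ¬ Sat H φ σ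

-- A failing ∀ contributes one counterexample vertex, a failing conjunction needs the witnesses of
-- one side only, and a failing disjunction unites those of both sides; `len` pays for each of them.
-- This turns lower bounds on numbers of vertices into lower bounds on length.
univ-refutation : ∀ {k} {φ : Formula k} → Univ φ → ∀ G ρ → ¬ Sat G φ ρ →
                  ∃ λ L → length L ≤ len φ × Refutes φ G ρ L
univ-refutation {φ = φ} (qf q) G ρ n =
  [] , z≤n , λ ι _ p s → n (to (qf-invariant ι φ q p) s)
univ-refutation {φ = φ ∧' ψ} (and u v) G ρ n with sat? G φ ρ
... | no ¬s = let L , l , r = univ-refutation u G ρ ¬s in
  L , ℕₚ.≤-trans l (ℕₚ.≤-trans (ℕₚ.m≤m+n _ (len ψ)) (ℕₚ.m≤n+m _ 3)) , λ ι c p (s , _) → r ι c p s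
... | yes s = let L , l , r = univ-refutation v G ρ (λ t → n (s , t)) in
  L , ℕₚ.≤-trans l (ℕₚ.m≤n+m _ (3 + len φ)) , λ ι c p (_ , t) → r ι c p t
univ-refutation {φ = φ ∨' ψ} (or u v) G ρ n =
  let L , l , r  = univ-refutation u G ρ (n ∘ inj₁)
      L' , l' , r' = univ-refutation v G ρ (n ∘ inj₂)
  in L List.++ L'
   , ℕₚ.≤-trans (ℕₚ.≤-reflexive (length-++ L)) (ℕₚ.≤-trans (ℕₚ.+-mono-≤ l l') (ℕₚ.m≤n+m _ 3))
   , λ { ι c p (inj₁ s) → r ι (c ∘ ∈-++⁺ˡ) p s
       ; ι c p (inj₂ s) → r' ι (c ∘ ∈-++⁺ʳ L) p s }
univ-refutation {φ = ∀' φ} (all u) G ρ n =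
  let a , ¬s = Finₚ.¬∀⟶∃¬ _ _ (λ a → sat? G φ (a ∷ ρ)) n
      L , l , r = univ-refutation u G (a ∷ ρ) ¬s
  in a ∷ L , s≤s (ℕₚ.m≤n⇒m≤1+n l)
   , λ ι c p s → let x , e = c (here refl) in
       r ι (c ∘ there) (along-∷ ι e p) (s x)

-- Finite graphs as adjacency matrices, and induced subgraphs.

Matrix : ℕ → Set
Matrix m = Vec (Vec Bool m) m

entry : ∀ {m} → Matrix m → Fin m → Fin m → Bool
entry M i j = lookup (lookup M i) j

IsAdjacency : ∀ {m} → Matrix m → Set
IsAdjacency M = (∀ i → entry M i i ≡ false) × (∀ i j → entry M i j ≡ entry M j i)

isAdjacency? : ∀ {m} (M : Matrix m) → Dec (IsAdjacency M)
isAdjacency? M = Finₚ.all? (λ i → entry M i i ≟ false)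
           ×-dec Finₚ.all? (λ i → Finₚ.all? λ j → entry M i j ≟ entry M j i)

-- Graphs come from tables rather than functions so that a conjunction can range over all graphs of
-- a given order.
matrixGraph : ∀ {m} (M : Matrix m) → IsAdjacency M → FinGraph
matrixGraph {m} M (i , s) = record { size = m ; adj = entry M ; irrefl = i ; sym = s }

-- Removes repetitions from L, because the vertex set of an induced subgraph has to be some `Fin m`.
enumerate-list : ∀ {n} (L : List (Fin n)) →
  ∃ λ m → m ≤ length L × Σ (Fin m → Fin n) λ f →
    (∀ {i j} → f i ≡ f j → i ≡ j) × (∀ {v} → v ∈ L → ∃ λ i → f i ≡ v)
enumerate-list [] = 0 , z≤n , (λ ()) , (λ {i} → ⊥-elim (Finₚ.¬Fin0 i)) , λ ()
enumerate-list (x ∷ L) with enumerate-list L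
... | m , l , f , inj , cov with Finₚ.any? (λ i → f i Finₚ.≟ x)
...   | yes p = m , ℕₚ.m≤n⇒m≤1+n l , f , inj , λ { (here refl) → p ; (there q) → cov q }
...   | no ¬p = suc m , s≤s l , g , g-inj , λ { (here refl) → zero , refl
                                               ; (there q) → let i , e = cov q in suc i , e }
  where
  g : Fin (suc m) → _
  g zero    = x
  g (suc i) = f i
  g-inj : ∀ {i j} → g i ≡ g j → i ≡ j
  g-inj {zero}  {zero}  e = refl
  g-inj {zero}  {suc j} e = ⊥-elim (¬p (j , sym e))
  g-inj {suc i} {zero}  e = ⊥-elim (¬p (i , e))
  g-inj {suc i} {suc j} e = cong suc (inj e)

record Subgraph (G : FinGraph) (L : List (Vertex G)) : Set where
  field
    order   : ℕ
    small   : order ≤ length L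
    matrix  : Matrix order
    isAdj   : IsAdjacency matrix
    incl    : matrixGraph matrix isAdj ↪ G
    covers  : L CoveredBy incl

  graph : FinGraph
  graph = matrixGraph matrix isAdj

induced : ∀ G L → Subgraph G L
induced G L with enumerate-list L
... | m , l , f , inj , cov = record
  { order  = m
  ; small  = l
  ; matrix = M
  ; isAdj  = (λ i → trans (M≡ i i) (irrefl G (f i)))
           , (λ i j → trans (M≡ i j) (trans (adj-sym G (f i) (f j)) (sym (M≡ j i))))
  ; incl   = record { fn = f ; fn-inj = inj ; fn-adj = M≡ }
  ; covers = cov
  }
  where
  M : Matrix m
  M = tabulate λ i → tabulate λ j → adj G (f i) (f j)
  M≡ : ∀ i j → entry M i j ≡ adj G (f i) (f j)
  M≡ i j = trans (cong (λ r → lookup r j) (lookup∘tabulate _ i)) (lookup∘tabulate _ j)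

-- Finite disjunctions and conjunctions, universal closure.

disj : ∀ {k} n → (Fin (suc n) → Formula k) → Formula k
disj zero    f = f zero
disj (suc n) f = f zero ∨' disj n (f ∘ suc)

disj-universal : ∀ {k} n {f : Fin (suc n) → Formula k} → (∀ i → IsUniversal (f i)) →
                 IsUniversal (disj n f)
disj-universal zero    u = u zero
disj-universal (suc n) u = u-∨ (u zero) (disj-universal n (u ∘ suc))

disj-sat : ∀ {G k} n {f : Fin (suc n) → Formula k} {ρ} →
           Sat G (disj n f) ρ ⇔ ∃ λ i → Sat G (f i) ρ
disj-sat zero    = mk⇔ (zero ,_) λ { (zero , s) → s }
disj-sat {G} (suc n) {f} {ρ} = mk⇔
  (λ { (inj₁ s) → zero , s ; (inj₂ s) → let i , t = to ih s in suc i , t })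
  (λ { (zero , s) → inj₁ s ; (suc i , s) → inj₂ (from ih (i , s)) })
  where
  ih : Sat G (disj n (f ∘ suc)) ρ ⇔ ∃ λ i → Sat G (f (suc i)) ρ
  ih = disj-sat n

-- An operation on families of formulas instead of a list of instances, so that conjunctions over
-- vectors and matrices arise by iteration.
Conjunction : Set → Set
Conjunction A = ∀ {k} → (A → Formula k) → Formula k

record IsConjunction {A : Set} (c : Conjunction A) : Set where
  field
    universal : ∀ {k} {f : A → Formula k} → (∀ a → IsUniversal (f a)) → IsUniversal (c f)
    sat       : ∀ {G k} (f : A → Formula k) {ρ} → Sat G (c f) ρ ⇔ (∀ a → Sat G (f a) ρ)
open IsConjunction

conjBool : Conjunction Bool
conjBool f = f true ∧' f false

conjBool-is : IsConjunction conjBool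
conjBool-is .universal u = u-∧ (u true) (u false)
conjBool-is .sat f = mk⇔ (λ { (s , t) true → s ; (s , t) false → t }) (λ h → h true , h false)

conjVec : ∀ {A} → Conjunction A → ∀ n → Conjunction (Vec A n)
conjVec c zero    f = f []
conjVec c (suc n) f = c λ a → conjVec c n λ v → f (a ∷ v)

conjVec-is : ∀ {A} {c : Conjunction A} → IsConjunction c → ∀ n → IsConjunction (conjVec c n)
conjVec-is p zero .universal u = u []
conjVec-is p zero .sat f = mk⇔ (λ { s [] → s }) (λ h → h [])
conjVec-is p (suc n) .universal u =
  p .universal λ a → conjVec-is p n .universal λ v → u (a ∷ v)
conjVec-is p (suc n) .sat f = mk⇔
  (λ { s (a ∷ v) → to (conjVec-is p n .sat _) (to (p .sat _) s a) v })
  (λ h → from (p .sat _) λ a → from (conjVec-is p n .sat _) λ v → h (a ∷ v))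

conjMatrix : ∀ m → Conjunction (Matrix m)
conjMatrix m = conjVec (conjVec conjBool m) m

conjMatrix-is : ∀ m → IsConjunction (conjMatrix m)
conjMatrix-is m = conjVec-is (conjVec-is conjBool-is m) m

close : ∀ n → Formula n → Sentence
close zero    φ = φ
close (suc n) φ = close n (∀' φ)

close-universal : ∀ n {φ : Formula n} → IsUniversal φ → IsUniversal (close n φ)
close-universal zero    u = u
close-universal (suc n) u = close-universal n (u-∀ u)

close-sat : ∀ {G} n {φ : Formula n} → (G ⊨ close n φ) ⇔ (∀ ρ → Sat G φ ρ)
close-sat zero    = mk⇔ (λ { s [] → s }) (λ h → h [])
close-sat {G} (suc n) {φ} = mk⇔
  (λ { s (a ∷ ρ) → to (close-sat {G} n) s ρ a })
  (λ h → from (close-sat {G} n) λ ρ a → h (a ∷ ρ))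

-- Forbidden induced subgraphs.

-- The disjunction over all i and j says that the assignment is not an isomorphism
-- from the graph on Fin (suc n) with adjacency matrix M onto an induced subgraph.

differsAt : ∀ {k} → Bool → Fin k → Fin k → Formula k
differsAt true  i j = ¬' (E i j)
differsAt false i j = E i j

collideAt : ∀ {k} → Fin k → Fin k → Formula k
collideAt i j with i Finₚ.≟ j
-- A contradiction, since the diagonal is no collision.
... | yes _ = ¬' (i ≐ i)
... | no  _ = i ≐ j

excludes : ∀ {n} → Matrix (suc n) → Formula (suc n)
excludes {n} M = disj n λ i → disj n λ j → differsAt (entry M i j) i j ∨' collideAt i j

excludes-universal : ∀ {n} (M : Matrix (suc n)) → IsUniversal (excludes M)
excludes-universal {n} M =
  disj-universal n λ i → disj-universal n λ j → u-∨ (differs (entry M i j) i j) (collide i j)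
  where
  differs : ∀ b (i j : Fin (suc n)) → IsUniversal (differsAt b i j)
  differs true  i j = u-neg (at-E i j)
  differs false i j = u-atom (at-E i j)
  collide : ∀ (i j : Fin (suc n)) → IsUniversal (collideAt i j)
  collide i j with i Finₚ.≟ j
  ... | yes _ = u-neg (at-eq i i)
  ... | no  _ = u-atom (at-eq i j)

module _ {G : FinGraph} {n : ℕ} (M : Matrix (suc n)) (isAdj : IsAdjacency M) where

  ¬excludes⇒↪ : ∀ ρ → ¬ Sat G (excludes M) ρ → matrixGraph M isAdj ↪ G
  ¬excludes⇒↪ ρ n∄ = record
    { fn = lookup ρ
    ; fn-inj = λ {i} {j} → collide i j
    ; fn-adj = λ i j → differ (entry M i j) i j λ s → none i j (inj₁ s)
    }
    where
    none : ∀ i j → ¬ Sat G (differsAt (entry M i j) i j ∨' collideAt i j) ρ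
    none i j s = n∄ (from (disj-sat n) (i , from (disj-sat n) (j , s)))
    differ : ∀ b i j → ¬ Sat G (differsAt b i j) ρ → b ≡ adj G (lookup ρ i) (lookup ρ j)
    differ true  i j h with adj G (lookup ρ i) (lookup ρ j)
    ... | true  = refl
    ... | false = ⊥-elim (h id)
    differ false i j h with adj G (lookup ρ i) (lookup ρ j)
    ... | true  = ⊥-elim (h tt)
    ... | false = refl
    collide : ∀ i j → lookup ρ i ≡ lookup ρ j → i ≡ j
    collide i j e with i Finₚ.≟ j | none i j
    ... | yes p | _ = p
    ... | no  _ | h = ⊥-elim (h (inj₂ e))

  ↪⇒¬excludes : ∀ (ι : matrixGraph M isAdj ↪ G) → ¬ Sat G (excludes M) (tabulate (fn ι))
  ↪⇒¬excludes ι s =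
    let i , s' = to (disj-sat n) s ; j , s″ = to (disj-sat n) s' in refute i j s″
    where
    eq : ∀ i → lookup (tabulate (fn ι)) i ≡ fn ι i
    eq = lookup∘tabulate (fn ι)
    differ : ∀ b i j → b ≡ adj G (fn ι i) (fn ι j) →
             ¬ Sat G (differsAt b i j) (tabulate (fn ι))
    differ true  i j e h rewrite eq i | eq j = h (subst T e tt)
    differ false i j e h rewrite eq i | eq j = subst T (sym e) h
    refute : ∀ i j → ¬ Sat G (differsAt (entry M i j) i j ∨' collideAt i j) (tabulate (fn ι))
    refute i j (inj₁ h) = differ (entry M i j) i j (fn-adj ι i j) h
    refute i j (inj₂ h) with i Finₚ.≟ j
    ... | yes _ = h refl
    ... | no i≢j = i≢j (fn-inj ι (trans (sym (eq i)) (trans h (eq j))))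

-- A hereditary class whose non-members are all certified by at most `suc bound` vertices is given
-- by finitely many forbidden induced subgraphs. The hypothesis `trivial-model` ensures that the
-- empty graph is not one of them, for universal sentences cannot forbid it.
module Universal
  (φ : Sentence)
  (hereditary : HereditaryClass (_⊨ φ))
  (bound : ℕ)
  (refutation : ∀ G → ¬ G ⊨ φ → ∃ λ L → length L ≤ suc bound × Refutes φ G [] L)
  (trivial-model : ∀ G → size G ≡ 0 → G ⊨ φ)
  where

  -- Tables that code no graph, or code a model of φ, get a trivially true formula, so that the
  -- conjunction can run over all matrices.
  forbidIfBad : ∀ {n} → Matrix (suc n) → Formula (suc n)
  forbidIfBad M with isAdjacency? M
  ... | no  _ = zero ≐ zero
  ... | yes p with sat? (matrixGraph M p) φ []
  ...   | yes _ = zero ≐ zero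
  ...   | no  _ = excludes M

  forbidIfBad-universal : ∀ {n} (M : Matrix (suc n)) → IsUniversal (forbidIfBad M)
  forbidIfBad-universal M with isAdjacency? M
  ... | no  _ = u-atom (at-eq zero zero)
  ... | yes p with sat? (matrixGraph M p) φ []
  ...   | yes _ = u-atom (at-eq zero zero)
  ...   | no  _ = excludes-universal M

  forbidIfBad-sound : ∀ {G n} → G ⊨ φ → ∀ (M : Matrix (suc n)) ρ → Sat G (forbidIfBad M) ρ
  forbidIfBad-sound {G} s M ρ with isAdjacency? M
  ... | no  _ = refl
  ... | yes p with sat? (matrixGraph M p) φ []
  ...   | yes _ = refl
  ...   | no ¬s = decidable-stable (sat? G (excludes M) ρ) λ h →
                   ¬s (hereditary (¬excludes⇒↪ M p ρ h) s)

  forbidIfBad-complete : ∀ {G n} (M : Matrix (suc n)) (p : IsAdjacency M) →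
    ¬ matrixGraph M p ⊨ φ → (ι : matrixGraph M p ↪ G) →
    ¬ Sat G (forbidIfBad M) (tabulate (fn ι))
  forbidIfBad-complete M p ¬s ι with isAdjacency? M
  ... | no ¬p = λ _ → ¬p p
  ... | yes p' with sat? (matrixGraph M p') φ []
  ...   | no  _ = ↪⇒¬excludes M p ι
  ...   | yes s = λ _ → ¬s (hereditary {matrixGraph M p} same s)
    where
    -- The two graphs have the same matrix and differ only in the proof that it is an adjacency
    -- matrix.
    same : matrixGraph M p ↪ matrixGraph M p'
    same = record { fn = id ; fn-inj = id ; fn-adj = λ _ _ → refl }

  forbidAll : ∀ n → Sentence
  forbidAll n = close (suc n) (conjMatrix (suc n) forbidIfBad)

  axioms : ℕ → Sentence
  axioms zero    = forbidAll zero
  axioms (suc n) = axioms n ∧' forbidAll (suc n)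

  forbidAll-universal : ∀ n → IsUniversal (forbidAll n)
  forbidAll-universal n =
    close-universal (suc n) (conjMatrix-is (suc n) .universal forbidIfBad-universal)

  axioms-universal : ∀ n → IsUniversal (axioms n)
  axioms-universal zero    = forbidAll-universal zero
  axioms-universal (suc n) = u-∧ (axioms-universal n) (forbidAll-universal (suc n))

  forbidAll-sound : ∀ {G} n → G ⊨ φ → G ⊨ forbidAll n
  forbidAll-sound {G} n s = from (close-sat {G} (suc n)) λ ρ →
    from (conjMatrix-is (suc n) .sat forbidIfBad) λ M → forbidIfBad-sound s M ρ

  axioms-sound : ∀ {G} n → G ⊨ φ → G ⊨ axioms n
  axioms-sound zero    s = forbidAll-sound zero s
  axioms-sound (suc n) s = axioms-sound n s , forbidAll-sound (suc n) s

  axioms⇒forbidAll : ∀ {G m} n → m ≤ n → G ⊨ axioms n → G ⊨ forbidAll m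
  axioms⇒forbidAll zero    z≤n s = s
  axioms⇒forbidAll (suc n) m≤ (s , t) with ℕₚ.m≤n⇒m<n∨m≡n m≤
  ... | inj₁ (s≤s m≤n) = axioms⇒forbidAll n m≤n s
  ... | inj₂ refl      = t

  -- The witnesses of a failure of φ induce a small subgraph that still violates φ, and the matrix
  -- of this subgraph is among the forbidden ones.
  axioms-complete : ∀ {G} → G ⊨ axioms bound → G ⊨ φ
  axioms-complete {G} s = decidable-stable (sat? G φ []) λ ¬s →
    let L , l , r = refutation G ¬s
    in violate (induced G L) l (λ {H} ι c → r {H} ι c (along λ ()))
    where
    violate : ∀ {L} (S : Subgraph G L) → length L ≤ suc bound →
              ¬ (∀ {H} (ι : H ↪ G) → L CoveredBy ι → ¬ H ⊨ φ)
    violate record { order = zero ; isAdj = p ; incl = ι ; covers = c } _ r =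
      r ι c (trivial-model _ refl)
    violate record { order = suc n ; small = m ; matrix = M ; isAdj = p ; incl = ι ; covers = c } l r =
      forbidIfBad-complete M p (r ι c) ι
        (to (conjMatrix-is (suc n) .sat forbidIfBad) (to (close-sat {G} (suc n)) forbidden _) M)
      where
      forbidden : G ⊨ forbidAll n
      forbidden = axioms⇒forbidAll {G} bound (ℕ.s≤s⁻¹ (ℕₚ.≤-trans m l)) s

  universal-axiomatization : Σ Sentence λ μ → IsUniversal μ × (_⊨ φ) ≡Graphfin μ
  universal-axiomatization =
    axioms bound , axioms-universal bound , λ G → axioms-sound bound , axioms-complete

-- At most len μ vertices of G witness the failure of μ, and the subgraph they induce still
-- violates φ.
universal-length : ∀ {φ μ : Sentence} {n} → IsUniversal μ → (_⊨ φ) ≡Graphfin μ →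
  ∀ G → ¬ G ⊨ φ → (∀ {H} → H ↪ G → ¬ H ⊨ φ → n ≤ size H) → n ≤ len μ
universal-length {φ} {μ} u same G ¬s large =
  let L , l , r = univ-refutation (IsUniversal⇒Univ u) G [] (¬s ∘ proj₂ (same G))
      open Subgraph (induced G L)
  in ℕₚ.≤-trans (large incl (λ t → r incl covers (along λ ()) (proj₁ (same graph) t)))
                (ℕₚ.≤-trans small l)


-- Binary digits, least significant first

increment : List Bool → List Bool
increment []          = true ∷ []
increment (false ∷ l) = true ∷ l
increment (true ∷ l)  = false ∷ increment l

digits : ℕ → List Bool
digits zero    = []
digits (suc n) = increment (digits n)

digit : List Bool → ℕ → Bool
digit []      i       = false
digit (b ∷ l) zero    = b
digit (b ∷ l) (suc i) = digit l i

-- Ackermann's membership relation on ℕ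
Bit : ℕ → ℕ → Set
Bit i n = T (digit (digits n) i)

¬Bit-zero : ∀ i → ¬ Bit i 0
¬Bit-zero i = id

-- The position of the lowest 0, where the carry of an increment comes to rest.
carry : List Bool → ℕ
carry []          = 0
carry (false ∷ l) = 0
carry (true ∷ l)  = suc (carry l)

carry∉ : ∀ l → ¬ T (digit l (carry l))
carry∉ []          = id
carry∉ (false ∷ l) = id
carry∉ (true ∷ l)  = carry∉ l

carry∈increment : ∀ l → T (digit (increment l) (carry l))
carry∈increment []          = tt
carry∈increment (false ∷ l) = tt
carry∈increment (true ∷ l)  = carry∈increment l

below-carry : ∀ l {i} → i < carry l → T (digit l i) × ¬ T (digit (increment l) i)
below-carry (true ∷ l) {zero}  _       = tt , id
below-carry (true ∷ l) {suc i} (s≤s p) = below-carry l p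

above-carry : ∀ l {i} → carry l < i → digit (increment l) i ≡ digit l i
above-carry []          {suc i} _       = refl
above-carry (false ∷ l) {suc i} _       = refl
above-carry (true ∷ l)  {suc i} (s≤s p) = above-carry l p

value : List Bool → ℕ
value []          = 0
value (false ∷ l) = value l + value l
value (true ∷ l)  = suc (value l + value l)

value-increment : ∀ l → value (increment l) ≡ suc (value l)
value-increment []          = refl
value-increment (false ∷ l) = refl
value-increment (true ∷ l) rewrite value-increment l = cong suc (ℕₚ.+-suc (value l) (value l))

value-digits : ∀ n → value (digits n) ≡ n
value-digits zero    = refl
value-digits (suc n) = trans (value-increment (digits n)) (cong suc (value-digits n))

2^≤value : ∀ l {i} → T (digit l i) → 2 ^ i ≤ value l
2^≤value (true ∷ l)  {zero}  _ = s≤s z≤n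
2^≤value (false ∷ l) {suc i} t rewrite ℕₚ.+-identityʳ (2 ^ i) =
  ℕₚ.+-mono-≤ (2^≤value l t) (2^≤value l t)
2^≤value (true ∷ l)  {suc i} t rewrite ℕₚ.+-identityʳ (2 ^ i) =
  ℕₚ.m≤n⇒m≤1+n (ℕₚ.+-mono-≤ (2^≤value l t) (2^≤value l t))

Bit⇒2^≤ : ∀ {i n} → Bit i n → 2 ^ i ≤ n
Bit⇒2^≤ {i} {n} t = subst (2 ^ i ≤_) (value-digits n) (2^≤value (digits n) t)

n<2^n : ∀ n → n < 2 ^ n
n<2^n zero    = s≤s z≤n
n<2^n (suc n) = ℕₚ.≤-trans (ℕₚ.+-mono-≤ (ℕₚ.m^n>0 2 n) (n<2^n n))
  (ℕₚ.≤-reflexive (cong (2 ^ n +_) (sym (ℕₚ.+-identityʳ (2 ^ n)))))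

Bit⇒< : ∀ {i n} → Bit i n → i < n
Bit⇒< {i} t = ℕₚ.<-≤-trans (n<2^n i) (Bit⇒2^≤ t)

-- Restricted to positive numbers because 0 has the empty list of digits.
digits-double : ∀ n → digits (suc n + suc n) ≡ false ∷ digits (suc n)
digits-double zero = refl
digits-double (suc n) rewrite ℕₚ.+-suc n (suc n) | digits-double n = refl

digit-value : ∀ l i → digit (digits (value l)) i ≡ digit l i
digit-value [] i = refl
digit-value (false ∷ l) i with value l | digit-value l
digit-value (false ∷ l) zero    | zero  | ih = refl
digit-value (false ∷ l) (suc i) | zero  | ih = ih i
digit-value (false ∷ l) i       | suc n | ih rewrite digits-double n with i
... | zero  = refl
... | suc j = ih j
digit-value (true ∷ l) i with value l | digit-value l
digit-value (true ∷ l) zero    | zero  | ih = refl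
digit-value (true ∷ l) (suc i) | zero  | ih = ih i
digit-value (true ∷ l) i       | suc n | ih rewrite digits-double n with i
... | zero  = refl
... | suc j = ih j

mark : ℕ → List Bool → List Bool
mark zero    []      = true ∷ []
mark zero    (_ ∷ l) = true ∷ l
mark (suc i) []      = false ∷ mark i []
mark (suc i) (b ∷ l) = b ∷ mark i l

digit-mark : ∀ i l j → T (digit (mark i l) j) ⇔ (j ≡ i ⊎ T (digit l j))
digit-mark zero []      zero    = mk⇔ (λ _ → inj₁ refl) _
digit-mark zero []      (suc j) = mk⇔ (λ ()) λ { (inj₁ ()) ; (inj₂ ()) }
digit-mark zero (_ ∷ l) zero    = mk⇔ (λ _ → inj₁ refl) _
digit-mark zero (_ ∷ l) (suc j) = mk⇔ inj₂ λ { (inj₁ ()) ; (inj₂ t) → t }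
digit-mark (suc i) []      zero    = mk⇔ (λ ()) λ { (inj₁ ()) ; (inj₂ ()) }
digit-mark (suc i) []      (suc j) = mk⇔
  (λ t → Sum.map (cong suc) id (to (digit-mark i [] j) t))
  (λ { (inj₁ refl) → from (digit-mark i [] j) (inj₁ refl) ; (inj₂ ()) })
digit-mark (suc i) (b ∷ l) zero    = mk⇔ inj₂ λ { (inj₁ ()) ; (inj₂ t) → t }
digit-mark (suc i) (b ∷ l) (suc j) = mk⇔
  (λ t → Sum.map (cong suc) id (to (digit-mark i l j) t))
  (λ { (inj₁ refl) → from (digit-mark i l j) (inj₁ refl)
     ; (inj₂ t) → from (digit-mark i l j) (inj₂ t) })

-- Ackermann's code of the finite set of members of L.
code : List ℕ → ℕ
code L = value (List.foldr mark [] L)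

∈-marked : ∀ L i → T (digit (List.foldr mark [] L) i) ⇔ i ∈ L
∈-marked []      i = mk⇔ (λ ()) λ ()
∈-marked (x ∷ L) i = mk⇔
  (λ t → found (to (digit-mark x _ i) t))
  (λ { (here e)  → from (digit-mark x _ i) (inj₁ e)
     ; (there p) → from (digit-mark x _ i) (inj₂ (from (∈-marked L i) p)) })
  where
  found : i ≡ x ⊎ T (digit (List.foldr mark [] L) i) → i ∈ x ∷ L
  found (inj₁ e) = here e
  found (inj₂ t) = there (to (∈-marked L i) t)

Bit-code : ∀ L i → Bit i (code L) ⇔ i ∈ L
Bit-code L i = mk⇔
  (λ t → to (∈-marked L i) (subst T e t))
  (λ p → subst T (sym e) (from (∈-marked L i) p))
  where e = digit-value (List.foldr mark [] L) i

-- First-order formulas over initial segments {0,…,M} of ℕ with order and membership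

data Arith : ℕ → Set where
  le mem   : ∀ {n} → Fin n → Fin n → Arith n
  neg      : ∀ {n} → Arith n → Arith n
  conj alt : ∀ {n} → Arith n → Arith n → Arith n
  all ex   : ∀ {n} → Arith (suc n) → Arith n

infixr 6 _&_
_&_ : ∀ {n} → Arith n → Arith n → Arith n
_&_ = conj

-- Membership is a parameter R because the relation read off a graph is known to be `Bit` only after
-- `bitRule` has been evaluated with it.
module Semantics (R : ℕ → ℕ → Set) (M : ℕ) where

  Holds : ∀ {n} → Arith n → Vec ℕ n → Set
  Holds (le x y)   ρ = lookup ρ x ≤ lookup ρ y
  Holds (mem x y)  ρ = R (lookup ρ x) (lookup ρ y)
  Holds (neg ψ)    ρ = ¬ Holds ψ ρ
  Holds (conj ψ χ) ρ = Holds ψ ρ × Holds χ ρ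
  Holds (alt ψ χ)  ρ = Holds ψ ρ ⊎ Holds χ ρ
  Holds (all ψ)    ρ = ∀ z → z ≤ M → Holds ψ (z ∷ ρ)
  Holds (ex ψ)     ρ = ∃ λ z → z ≤ M × Holds ψ (z ∷ ρ)

isZero : ∀ {n} → Fin n → Arith n
isZero x = all (le (suc x) zero)

lt same isSuc : ∀ {n} → Fin n → Fin n → Arith n
lt x y    = neg (le y x)
same x y  = le x y & le y x
isSuc x y = lt x y & all (alt (le zero (suc x)) (le (suc y) zero))

-- A set s of codes {i, {K, v}} with i, v < K represents the set of the pairs (i , v).
pairIn : ∀ {n} → Fin n → Fin n → Fin n → Fin n → Arith n
pairIn s K i v =
  ex (mem 0F (suc s) & mem (suc i) 0F & lt (suc i) (suc K) &
      ex (mem 0F 1F & mem (2 ↑ʳ K) 0F & mem (2 ↑ʳ v) 0F & lt (2 ↑ʳ v) (2 ↑ʳ K)))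

exs : ∀ m {n} → Arith (m + n) → Arith n
exs zero    ψ = ψ
exs (suc m) ψ = exs m (ex ψ)

-- In the case of primitive recursion, s is a set of pairs each of which is justified by the
-- recursion equations from another pair of s.
mutual
  graph : ∀ {k n} → PR k → (Fin k → Fin n) → Fin n → Arith n
  graph zer         vs y = isZero y
  graph succ        vs y = isSuc (vs zero) y
  graph (proj i)    vs y = same (vs i) y
  graph (comp {m = m} g hs) vs y =
    exs m (graphs hs (λ i → m ↑ʳ vs i) (λ i → i ↑ˡ _) (graph g (λ i → i ↑ˡ _) (m ↑ʳ y)))
  graph (prec g h) vs y = ex (ex
    (pairIn 1F 0F (2 ↑ʳ vs zero) (2 ↑ʳ y) &
     all (all (alt (neg (pairIn 3F 2F 1F 0F))
       (alt (isZero 1F & graph g (λ i → 4 ↑ʳ vs (suc i)) 0F)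
            (ex (ex (isSuc 1F 3F & pairIn 5F 4F 1F 0F &
              graph h (1F ◂ 0F ◂ λ i → 6 ↑ʳ vs (suc i)) 2F))))))))
  graph (mini p) vs y =
    ex (isZero 0F & graph p (suc y ◂ λ i → suc (vs i)) 0F) &
    all (alt (le (suc y) 0F)
      (ex (ex (isSuc 1F 0F & graph p (2F ◂ λ i → 3 ↑ʳ vs i) 0F))))

  graphs : ∀ {k m n} → Vec (PR k) m → (Fin k → Fin n) → (Fin m → Fin n) → Arith n → Arith n
  graphs []       vs ys ψ = ψ
  graphs (h ∷ hs) vs ys ψ = graph h vs (ys zero) & graphs hs vs (ys ∘ suc) ψ

-- Determinism of evaluation and soundness of the formulas `graph`.

mutual
  eval-deterministic : ∀ {k} {p : PR k} {xs y z} → Eval p xs y → Eval p xs z → y ≡ z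
  eval-deterministic ev-zer ev-zer = refl
  eval-deterministic ev-succ ev-succ = refl
  eval-deterministic ev-proj ev-proj = refl
  eval-deterministic (ev-comp ds d) (ev-comp es e)
    rewrite evals-deterministic ds es = eval-deterministic d e
  eval-deterministic (ev-prec0 d) (ev-prec0 e) = eval-deterministic d e
  eval-deterministic (ev-precS d d') (ev-precS e e')
    rewrite eval-deterministic d e = eval-deterministic d' e'
  eval-deterministic (ev-mini {n = m} d ds) (ev-mini {n = n} e es) with ℕₚ.<-cmp m n
  ... | tri≈ _ m≡n _ = m≡n
  ... | tri< m<n _ _ with () ← eval-deterministic d (proj₂ (es m m<n))
  ... | tri> _ _ n<m with ds n n<m
  ...   | _ , d' with () ← eval-deterministic d' e

  evals-deterministic : ∀ {k m} {hs : Vec (PR k) m} {xs ys zs} →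
                        EvalVec hs xs ys → EvalVec hs xs zs → ys ≡ zs
  evals-deterministic [] [] = refl
  evals-deterministic (d ∷ ds) (e ∷ es) =
    cong₂ _∷_ (eval-deterministic d e) (evals-deterministic ds es)

record Reads {k n} (ρ : Vec ℕ n) (vs : Fin k → Fin n) (xs : Vec ℕ k) : Set where
  constructor reads
  field read : ∀ i → lookup ρ (vs i) ≡ lookup xs i
open Reads

reads-∷ : ∀ {k n} {ρ : Vec ℕ n} {vs : Fin k → Fin n} {xs x y} →
          lookup ρ x ≡ y → Reads ρ vs xs → Reads ρ (x ◂ vs) (y ∷ xs)
reads-∷ p q .read zero    = p
reads-∷ p q .read (suc i) = q .read i

record Bounded (M : ℕ) {n} (ρ : Vec ℕ n) : Set where
  constructor bounded
  field bound : ∀ i → lookup ρ i ≤ M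
open Bounded

bounded-[] : ∀ {M} → Bounded M []
bounded-[] .bound ()

bounded-∷ : ∀ {M n} {ρ : Vec ℕ n} {z} → z ≤ M → Bounded M ρ → Bounded M (z ∷ ρ)
bounded-∷ p q .bound zero    = p
bounded-∷ p q .bound (suc i) = q .bound i

bounded-++ : ∀ {M m n} {ys : Vec ℕ m} {ρ : Vec ℕ n} →
             Bounded M ys → Bounded M ρ → Bounded M (ys ++ ρ)
bounded-++ {ys = []}     b b' = b'
bounded-++ {ys = y ∷ ys} b b' = bounded-∷ (b .bound zero) (bounded-++ (bounded (b .bound ∘ suc)) b')

module _ {R : ℕ → ℕ → Set} {M : ℕ} where
  open Semantics R M

  exs-holds : ∀ m {n} {ψ : Arith (m + n)} {ρ} →
              Holds (exs m ψ) ρ ⇔ ∃ λ (ys : Vec ℕ m) → Bounded M ys × Holds ψ (ys ++ ρ)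
  exs-holds zero = mk⇔ (λ h → [] , bounded-[] , h) λ { ([] , _ , h) → h }
  exs-holds (suc m) {ψ = ψ} {ρ} = mk⇔
    (λ h → let ys , b , z , z≤ , h' = to ih h in z ∷ ys , bounded-∷ z≤ b , h')
    (λ { (z ∷ ys , b , h) → from ih (ys , bounded (b .bound ∘ suc) , z , b .bound zero , h) })
    where
    ih : Holds (exs m (ex ψ)) ρ ⇔ ∃ λ ys → Bounded M ys × Holds (ex ψ) (ys ++ ρ)
    ih = exs-holds m

  isZero-sound : ∀ {n} (x : Fin n) ρ → Holds (isZero x) ρ → lookup ρ x ≡ 0
  isZero-sound x ρ h = ℕₚ.n≤0⇒n≡0 (h 0 z≤n)

  isZero-complete : ∀ {n} (x : Fin n) ρ → lookup ρ x ≡ 0 → Holds (isZero x) ρ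
  isZero-complete x ρ e z _ rewrite e = z≤n

  isSuc-sound : ∀ {n} (x y : Fin n) {ρ} → Bounded M ρ →
                Holds (isSuc x y) ρ → lookup ρ y ≡ suc (lookup ρ x)
  isSuc-sound x y {ρ} b (y≰x , h) with ℕₚ.≰⇒> y≰x
  ... | x<y with h (suc (lookup ρ x)) (ℕₚ.≤-trans x<y (b .bound y))
  ...   | inj₁ p = ⊥-elim (ℕₚ.1+n≰n p)
  ...   | inj₂ p = ℕₚ.≤-antisym p x<y

  isSuc-complete : ∀ {n} (x y : Fin n) ρ →
                   lookup ρ y ≡ suc (lookup ρ x) → Holds (isSuc x y) ρ
  isSuc-complete x y ρ e rewrite e = ℕₚ.1+n≰n , λ z _ → ℕₚ.≤-<-connex z (lookup ρ x)

  mutual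
    -- Valid for every R and M: whatever s and K are, if each pair of s is justified by another one,
    -- then induction on the first component turns every pair of s into a derivation.
    graph-sound : ∀ {k n} (p : PR k) {vs} {y : Fin n} {ρ xs} → Reads ρ vs xs → Bounded M ρ →
                  Holds (graph p vs y) ρ → Eval p xs (lookup ρ y)
    graph-sound zer {y = y} {ρ} r b h = subst (Eval zer _) (sym (isZero-sound y ρ h)) ev-zer
    graph-sound succ {vs} {y} {xs = x ∷ []} r b h =
      subst (Eval succ _) (sym (trans (isSuc-sound (vs zero) y b h) (cong suc (r .read zero)))) ev-succ
    graph-sound (proj i) r b (h , h') =
      subst (Eval (proj i) _) (trans (sym (r .read i)) (ℕₚ.≤-antisym h h')) ev-proj
    graph-sound (comp {m = m} g hs) {vs} {y} {ρ} {xs} r b h =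
      let ys , b' , h' = to (exs-holds m) h
          b″ = bounded-++ b' b
          r' = reads (lookup-++ˡ ys ρ)
          r″ = reads λ i → trans (lookup-++ʳ ys ρ (vs i)) (r .read i)
          ds , hg = graphs-sound hs r″ r' b″ h'
      in ev-comp ds (subst (Eval g ys) (lookup-++ʳ ys ρ y) (graph-sound g r' b″ hg))
    graph-sound (prec g h) {vs} {y} {ρ} {x ∷ xs} r b (s , s≤ , K , K≤ , start , justified) =
      sound x (subst (_≤ M) (r .read zero) (b .bound (vs zero))) (lookup ρ y) (b .bound y)
        -- `Holds` depends only on the values of the variables, so `start` is an instance of `Pair`
        -- by computation.
        (subst (λ x → Pair x (lookup ρ y)) (r .read zero) start)
      where
      Pair : ℕ → ℕ → Set
      Pair i v = Holds (pairIn 3F 2F 1F 0F) (v ∷ i ∷ K ∷ s ∷ ρ)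
      b₂ : Bounded M (K ∷ s ∷ ρ)
      b₂ = bounded-∷ K≤ (bounded-∷ s≤ b)
      sound : ∀ i → i ≤ M → ∀ v → v ≤ M → Pair i v → Eval (prec g h) (i ∷ xs) v
      sound i i≤ v v≤ p with justified i i≤ v v≤
      ... | inj₁ ¬p = ⊥-elim (¬p p)
      sound zero i≤ v v≤ p | inj₂ (inj₁ (z , hg)) =
        ev-prec0 (graph-sound g (reads (r .read ∘ suc)) (bounded-∷ v≤ (bounded-∷ i≤ b₂)) hg)
      sound (suc i) i≤ v v≤ p | inj₂ (inj₁ (z , hg))
        with () ← isZero-sound 1F (v ∷ suc i ∷ K ∷ s ∷ ρ) z
      sound i i≤ v v≤ p | inj₂ (inj₂ (j , j≤ , u , u≤ , hs , p' , hh))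
        with bounded-∷ u≤ (bounded-∷ j≤ (bounded-∷ v≤ (bounded-∷ i≤ b₂)))
      sound zero i≤ v v≤ p | inj₂ (inj₂ (j , j≤ , u , u≤ , hs , p' , hh)) | b₆
        with () ← isSuc-sound 1F 3F b₆ hs
      sound (suc i) i≤ v v≤ p | inj₂ (inj₂ (j , j≤ , u , u≤ , hs , p' , hh)) | b₆
        with refl ← isSuc-sound 1F 3F b₆ hs =
        ev-precS (sound i j≤ u u≤ p')
          (graph-sound h (reads-∷ refl (reads-∷ refl (reads (r .read ∘ suc)))) b₆ hh)
    graph-sound (mini p) {vs} {y} {ρ} {xs} r b ((z , z≤ , hz , h0) , h) = ev-mini
      (subst (Eval p _) (isZero-sound 0F (z ∷ ρ) hz)
        (graph-sound p (reads-∷ refl (reads (r .read))) (bounded-∷ z≤ b) h0))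
      below
      where
      below : ∀ u → u < lookup ρ y → ∃ λ w → Eval p (u ∷ xs) (suc w)
      below u u<y with ℕₚ.≤-trans (ℕₚ.<⇒≤ u<y) (b .bound y)
      ... | u≤ with h u u≤
      ...   | inj₁ y≤u = ⊥-elim (ℕₚ.<⇒≱ u<y y≤u)
      ...   | inj₂ (w , w≤ , w' , w'≤ , hs , hp) =
        let b₃ = bounded-∷ w'≤ (bounded-∷ w≤ (bounded-∷ u≤ b))
        in w , subst (Eval p _) (isSuc-sound 1F 0F b₃ hs)
                 (graph-sound p (reads-∷ refl (reads (r .read))) b₃ hp)

    graphs-sound : ∀ {k m n} (hs : Vec (PR k) m) {vs ys} {ρ : Vec ℕ n} {xs us ψ} →
                   Reads ρ vs xs → Reads ρ ys us → Bounded M ρ →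
                   Holds (graphs hs vs ys ψ) ρ → EvalVec hs xs us × Holds ψ ρ
    graphs-sound [] {us = []} r r' b h = [] , h
    graphs-sound (p ∷ hs) {us = u ∷ us} r r' b (h , h') =
      let ds , hψ = graphs-sound hs r (reads (r' .read ∘ suc)) b h'
      in subst (Eval p _) (r' .read zero) (graph-sound p r b h) ∷ ds , hψ

-- Coded sets of pairs and completeness of the formulas `graph`.

pairCode : ℕ → ℕ × ℕ → ℕ
pairCode K (i , v) = code (i ∷ code (K ∷ v ∷ []) ∷ [])

pairSet : ℕ → List (ℕ × ℕ) → ℕ
pairSet K L = code (List.map (pairCode K) L)

BoundedPairs : ℕ → List (ℕ × ℕ) → Set
BoundedPairs K L = ∀ {i v} → (i , v) ∈ L → i < K × v < K

module _ {M : ℕ} where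
  open Semantics Bit M

  -- The code of {K, v} exceeds its member K and hence every first component, so the two members of
  -- a pair code cannot be confused; v is told from K by v < K. All witnesses lie below s, because
  -- members are smaller than their sets.
  pairIn-correct : ∀ {n} (s K i v : Fin n) ρ {L} →
    BoundedPairs (lookup ρ K) L → lookup ρ s ≡ pairSet (lookup ρ K) L → lookup ρ s ≤ M →
    Holds (pairIn s K i v) ρ ⇔ (lookup ρ i , lookup ρ v) ∈ L
  pairIn-correct s K i v ρ {L} bd es s≤ = mk⇔ sound complete
    where
    k = lookup ρ K
    x = lookup ρ i
    y = lookup ρ v
    sound : Holds (pairIn s K i v) ρ → (x , y) ∈ L
    sound (t , _ , t∈s , x∈t , x<k , w , _ , w∈t , k∈w , y∈w , y<k)
      with ∈-map⁻ (pairCode k) (to (Bit-code _ t) (subst (Bit t) es t∈s))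
    ... | (i' , v') , iv∈L , refl
      with to (Bit-code (i' ∷ code (k ∷ v' ∷ []) ∷ []) w) w∈t
         | to (Bit-code (i' ∷ code (k ∷ v' ∷ []) ∷ []) x) x∈t
    ... | here refl | _ = ⊥-elim (ℕₚ.<-asym (Bit⇒< k∈w) (proj₁ (bd iv∈L)))
    ... | there (here refl) | there (here e) =
      ⊥-elim (x<k (ℕₚ.<⇒≤ (subst (k <_) (sym e) (Bit⇒< k∈w))))
    ... | there (here refl) | here refl with to (Bit-code (k ∷ v' ∷ []) y) y∈w
    ...   | here e           = ⊥-elim (y<k (ℕₚ.≤-reflexive (sym e)))
    ...   | there (here refl) = iv∈L
    complete : (x , y) ∈ L → Holds (pairIn s K i v) ρ
    complete p = t , ℕₚ.≤-trans (ℕₚ.<⇒≤ (Bit⇒< t∈s)) s≤ , t∈s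
      , from (Bit-code (x ∷ w ∷ []) x) (here refl) , ℕₚ.<⇒≱ (proj₁ (bd p))
      , w , ℕₚ.≤-trans (ℕₚ.<⇒≤ (ℕₚ.<-trans (Bit⇒< w∈t) (Bit⇒< t∈s))) s≤ , w∈t
      , from (Bit-code (k ∷ y ∷ []) k) (here refl)
      , from (Bit-code (k ∷ y ∷ []) y) (there (here refl)) , ℕₚ.<⇒≱ (proj₂ (bd p))
      where
      t = pairCode k (x , y)
      w = code (k ∷ y ∷ [])
      t∈s : Bit t (lookup ρ s)
      t∈s = subst (Bit t) (sym es) (from (Bit-code _ t) (∈-map⁺ (pairCode k) p))
      w∈t : Bit w t
      w∈t = from (Bit-code (x ∷ w ∷ []) w) (there (here refl))

boundPairs : ∀ L → ∃ λ K → BoundedPairs K L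
boundPairs [] = 0 , λ ()
boundPairs ((i , v) ∷ L) = let K , b = boundPairs L in suc (i ⊔ v) ⊔ K ,
  λ { (here refl) → ℕₚ.≤-trans (s≤s (ℕₚ.m≤m⊔n i v)) (ℕₚ.m≤m⊔n _ K)
                  , ℕₚ.≤-trans (s≤s (ℕₚ.m≤n⊔m i v)) (ℕₚ.m≤m⊔n _ K)
    ; (there p) → ℕₚ.≤-trans (proj₁ (b p)) (ℕₚ.m≤n⊔m _ K)
                , ℕₚ.≤-trans (proj₂ (b p)) (ℕₚ.m≤n⊔m _ K) }

-- Merges the thresholds of the finitely many values that a minimization has to inspect.
uniformBound : ∀ n {P : ℕ → ℕ → Set} → (∀ {m T T'} → T ≤ T' → P m T → P m T') →
  (∀ m → m < n → ∃ λ T → P m T) → ∃ λ T → ∀ m → m < n → P m T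
uniformBound zero    mono f = 0 , λ _ ()
uniformBound (suc n) mono f =
  let T  , p = f n ℕₚ.≤-refl
      T' , q = uniformBound n mono λ m m<n → f m (ℕₚ.m<n⇒m<1+n m<n)
  in T ⊔ T' , λ m m<1+n → Sum.[ (λ m<n → mono (ℕₚ.m≤n⊔m T T') (q m m<n))
                                   , (λ { refl → mono (ℕₚ.m≤m⊔n T T') p }) ]
                                   (ℕₚ.m<1+n⇒m<n∨m≡n m<1+n)

-- T is a threshold from which on the computation, with all the sets that code it, fits into
-- {0,...,M}.
Defined : ∀ {k} → PR k → Vec ℕ k → ℕ → ℕ → Set
Defined {k} p xs y T = ∀ {M n} → T ≤ M → (ρ : Vec ℕ n) (vs : Fin k → Fin n) (w : Fin n) →
  Reads ρ vs xs → lookup ρ w ≡ y → Semantics.Holds Bit M (graph p vs w) ρ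

AllDefined : ∀ {k m} → Vec (PR k) m → Vec ℕ k → Vec ℕ m → ℕ → Set
AllDefined {k} {m} hs xs ys T = ∀ {M n} → T ≤ M →
  (ρ : Vec ℕ n) (vs : Fin k → Fin n) (us : Fin m → Fin n) (ψ : Arith n) →
  Reads ρ vs xs → Reads ρ us ys →
  Semantics.Holds Bit M ψ ρ → Semantics.Holds Bit M (graphs hs vs us ψ) ρ

Defined-mono : ∀ {k} {p : PR k} {xs y T T'} → T ≤ T' → Defined p xs y T → Defined p xs y T'
Defined-mono T≤T' d T'≤M = d (ℕₚ.≤-trans T≤T' T'≤M)

Justified : ∀ {k} → PR k → PR (suc (suc k)) → Vec ℕ k → ℕ → List (ℕ × ℕ) → Set
Justified g h xs T L = ∀ {i v} → (i , v) ∈ L →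
  (i ≡ 0 × Defined g xs v T) ⊎
  (∃₂ λ j u → i ≡ suc j × (j , u) ∈ L × Defined h (j ∷ u ∷ xs) v T)

mutual
  graph-complete : ∀ {k} {p : PR k} {xs y} → Eval p xs y → ∃ λ T → Defined p xs y T
  graph-complete ev-zer = 0 , λ _ ρ vs w r e → isZero-complete {Bit} w ρ e
  graph-complete ev-succ = 0 , λ _ ρ vs w r e →
    isSuc-complete {Bit} (vs zero) w ρ (trans e (cong suc (sym (r .read zero))))
  graph-complete (ev-proj {i = i}) = 0 , λ _ ρ vs w r e →
    ℕₚ.≤-reflexive (trans (r .read i) (sym e)) , ℕₚ.≤-reflexive (trans e (sym (r .read i)))
  graph-complete {xs = xs} (ev-comp {m = m} {g = g} {hs = hs} {ys = ys} ds d) =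
    let T  , b , q = graphs-complete ds
        T' , q'    = graph-complete d
    in T ⊔ T' , λ ≤M ρ vs w r e →
      let T≤M = ℕₚ.≤-trans (ℕₚ.m≤m⊔n T T') ≤M
          r'  = reads (lookup-++ˡ ys ρ)
      in from (exs-holds {Bit} m) (ys , bounded (λ i → ℕₚ.≤-trans (b .bound i) T≤M) ,
        q T≤M (ys ++ ρ) (λ i → m ↑ʳ vs i) (λ i → i ↑ˡ _) (graph g (λ i → i ↑ˡ _) (m ↑ʳ w))
          (reads λ i → trans (lookup-++ʳ ys ρ (vs i)) (r .read i)) r'
          (q' (ℕₚ.≤-trans (ℕₚ.m≤n⊔m T T') ≤M) (ys ++ ρ) (λ i → i ↑ˡ _) (m ↑ʳ w) r'
            (trans (lookup-++ʳ ys ρ w) e)))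
  graph-complete d@(ev-prec0 {g = g} {h} _) = prec-complete g h (trace d)
  graph-complete d@(ev-precS {g = g} {h} _ _) = prec-complete g h (trace d)
  graph-complete {xs = xs} (ev-mini {f = p} {n = n} d ds) =
    let T  , q = graph-complete d
        T' , q' = uniformBound n
                    (λ T≤ (w , w< , c) → w , ℕₚ.≤-trans w< T≤ , Defined-mono {p = p} T≤ c) below
    in T ⊔ T' , λ {M} ≤M ρ vs w r e →
      (0 , z≤n , isZero-complete {Bit} 0F (0 ∷ ρ) refl
         , q (ℕₚ.≤-trans (ℕₚ.m≤m⊔n T T') ≤M) (0 ∷ ρ) _ 0F (reads-∷ e (reads (r .read))) refl)
      , λ u _ → Sum.map id
          (λ u<w → let v , v<T' , c = q' u (subst (u <_) e u<w)
                       T'≤M = ℕₚ.≤-trans (ℕₚ.m≤n⊔m T T') ≤M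
                       v<M = ℕₚ.≤-trans v<T' T'≤M
                   in v , ℕₚ.<⇒≤ v<M , suc v , v<M
                    , isSuc-complete {Bit} 1F 0F (suc v ∷ v ∷ u ∷ ρ) refl
                    , c T'≤M (suc v ∷ v ∷ u ∷ ρ) _ 0F (reads-∷ refl (reads (r .read))) refl)
          (ℕₚ.≤-<-connex (lookup ρ w) u)
    where
    below : ∀ m → m < n → ∃ λ T → ∃ λ w → suc w ≤ T × Defined p (m ∷ xs) (suc w) T
    below m m<n with ds m m<n
    ... | w , e = let T , q = graph-complete e in
      suc w ⊔ T , w , ℕₚ.m≤m⊔n (suc w) T , Defined-mono {p = p} (ℕₚ.m≤n⊔m (suc w) T) q

  graphs-complete : ∀ {k m} {hs : Vec (PR k) m} {xs ys} → EvalVec hs xs ys →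
                    ∃ λ T → Bounded T ys × AllDefined hs xs ys T
  graphs-complete [] = 0 , bounded-[] , λ _ ρ vs us ψ r r' h → h
  graphs-complete (_∷_ {y = y} d ds) =
    let T , q = graph-complete d ; T' , b , q' = graphs-complete ds in
    y ⊔ (T ⊔ T') ,
    bounded-∷ (ℕₚ.m≤m⊔n y _)
      (bounded λ i → ℕₚ.≤-trans (b .bound i) (ℕₚ.≤-trans (ℕₚ.m≤n⊔m T T') (ℕₚ.m≤n⊔m y _))) ,
    λ ≤M ρ vs us ψ r r' h →
      let ≤M' = ℕₚ.≤-trans (ℕₚ.m≤n⊔m y _) ≤M in
      q (ℕₚ.≤-trans (ℕₚ.m≤m⊔n T T') ≤M') ρ vs (us zero) r (r' .read zero) ,
      q' (ℕₚ.≤-trans (ℕₚ.m≤n⊔m T T') ≤M') ρ vs (us ∘ suc) ψ r (reads (r' .read ∘ suc)) h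

  -- The history of the recursion from 0 to n, collected along the derivation, with one threshold
  -- for all of its steps.
  trace : ∀ {k} {g : PR k} {h n xs y} → Eval (prec g h) (n ∷ xs) y →
          ∃₂ λ T L → (n , y) ∈ L × Justified g h xs T L
  trace (ev-prec0 {y = y} d) =
    let T , q = graph-complete d in
    T , (0 , y) ∷ [] , here refl , λ { (here refl) → inj₁ (refl , q) }
  trace {g = g} {h} {xs = xs} (ev-precS {n = n} {y = y} {z} d e) =
    let T , L , ny∈L , just = trace d
        T' , q = graph-complete e
        ≤l = ℕₚ.m≤m⊔n T T'
    in T ⊔ T' , (suc n , z) ∷ L , here refl ,
       λ { (here refl) → inj₂ (n , y , refl , there ny∈L , Defined-mono {p = h} (ℕₚ.m≤n⊔m T T') q)
         ; (there p) → Sum.map (λ (e , c) → e , Defined-mono {p = g} ≤l c)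
             (λ (j , u , e , p' , c) → j , u , e , there p' , Defined-mono {p = h} ≤l c) (just p) }

  prec-complete : ∀ {k} (g : PR k) h {n xs y} →
    (∃₂ λ T L → (n , y) ∈ L × Justified g h xs T L) → ∃ λ T → Defined (prec g h) (n ∷ xs) y T
  prec-complete {k} g h {n} {xs} {y} (T , L , ny∈L , just) with boundPairs L
  -- The codes occurring in s lie below s and the entries of the pairs below K, so M has to exceed
  -- only T, s and K.
  ... | K , bd = T ⊔ (s ⊔ K) , holds
    where
    s = pairSet K L
    holds : Defined (prec g h) (n ∷ xs) y (T ⊔ (s ⊔ K))
    holds {M} {m} ≤M ρ vs w r e =
      s , s≤M , K , K≤M ,
      from (pair (2 ↑ʳ vs zero) (2 ↑ʳ w) (K ∷ s ∷ ρ) 1F 0F refl refl)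
        (subst₂ (λ a b → (a , b) ∈ L) (sym (r .read zero)) (sym e) ny∈L) ,
      λ i _ v _ → justify i v
      where
      open Semantics Bit M
      T≤M : T ≤ M
      T≤M = ℕₚ.≤-trans (ℕₚ.m≤m⊔n T _) ≤M
      s≤M : s ≤ M
      s≤M = ℕₚ.≤-trans (ℕₚ.≤-trans (ℕₚ.m≤m⊔n s K) (ℕₚ.m≤n⊔m T _)) ≤M
      K≤M : K ≤ M
      K≤M = ℕₚ.≤-trans (ℕₚ.≤-trans (ℕₚ.m≤n⊔m s K) (ℕₚ.m≤n⊔m T _)) ≤M
      pair : ∀ {n} (i v : Fin n) ρ s' K' → lookup ρ s' ≡ s → lookup ρ K' ≡ K →
             Holds (pairIn s' K' i v) ρ ⇔ (lookup ρ i , lookup ρ v) ∈ L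
      pair i v ρ s' K' es refl =
        pairIn-correct s' K' i v ρ bd es (subst (_≤ M) (sym es) s≤M)
      justify : ∀ i v → Holds
        (alt (neg (pairIn 3F 2F 1F 0F))
          (alt (isZero 1F & graph g (λ i → 4 ↑ʳ vs (suc i)) 0F)
            (ex (ex (isSuc 1F 3F & pairIn 5F 4F 1F 0F &
              graph h (1F ◂ 0F ◂ λ i → 6 ↑ʳ vs (suc i)) 2F)))))
        (v ∷ i ∷ K ∷ s ∷ ρ)
      justify i v with (i , v) ∈? L
      ... | no ∉L = inj₁ (∉L ∘ to (pair 1F 0F (v ∷ i ∷ K ∷ s ∷ ρ) 3F 2F refl refl))
      ... | yes ∈L with just ∈L
      ...   | inj₁ (z , c) = inj₂ (inj₁
        ( isZero-complete {Bit} {M} 1F (v ∷ i ∷ K ∷ s ∷ ρ) z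
        , c T≤M (v ∷ i ∷ K ∷ s ∷ ρ) (λ i → 4 ↑ʳ vs (suc i)) 0F (reads (r .read ∘ suc)) refl))
      ...   | inj₂ (j , u , e , ∈L' , c) = inj₂ (inj₂
        ( j , ℕₚ.≤-trans (ℕₚ.<⇒≤ (proj₁ (bd ∈L'))) K≤M
        , u , ℕₚ.≤-trans (ℕₚ.<⇒≤ (proj₂ (bd ∈L'))) K≤M
        , isSuc-complete {Bit} {M} 1F 3F (u ∷ j ∷ v ∷ i ∷ K ∷ s ∷ ρ) e
        , from (pair 1F 0F (u ∷ j ∷ v ∷ i ∷ K ∷ s ∷ ρ) 5F 4F refl refl) ∈L'
        , c T≤M (u ∷ j ∷ v ∷ i ∷ K ∷ s ∷ ρ) (1F ◂ 0F ◂ λ i → 6 ↑ʳ vs (suc i)) 2F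
            (reads-∷ refl (reads-∷ refl (reads (r .read ∘ suc)))) refl))

-- Towers of exponentials, the goal sentence and the bit rule.

code-singleton : ∀ i → code (i ∷ []) ≡ 2 ^ i
code-singleton zero    = refl
code-singleton (suc i) = cong₂ _+_ (code-singleton i)
  (trans (code-singleton i) (sym (ℕₚ.+-identityʳ (2 ^ i))))

Bit-2^ : ∀ i → Bit i (2 ^ i)
Bit-2^ i = subst (Bit i) (code-singleton i) (from (Bit-code (i ∷ []) i) (here refl))

tow : ℕ → ℕ
tow zero    = 0
tow (suc j) = 2 ^ tow j

-- 2^y is the least number that has y as a member. Expressing exponentiation by order and membership
-- lets each level of the tower cost only a constant length.
tower : ∀ {n} → ℕ → Fin n → Arith n
tower zero    x = isZero x
tower (suc j) x =
  ex (tower j 0F & mem 0F (suc x) & all (alt (neg (mem 1F 0F)) (le (2 ↑ʳ x) 0F)))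

goal : PR 1 → ℕ → Arith 0
goal c j = ex (tower j 0F & ex (graph c (λ _ → 1F) 0F))

-- The membership relation of y = x + 1 arises from that of x by binary increment.
bitRule : Arith 0
bitRule =
  all (alt (neg (isZero 0F)) (all (neg (mem 0F 1F)))) &
  all (all (alt (neg (isSuc 1F 0F))
    (ex (neg (mem 0F 2F) & mem 0F 1F &
      all (alt (le 1F 0F) (mem 0F 3F & neg (mem 0F 2F)) &
           alt (le 0F 1F) (alt (mem 0F 3F & mem 0F 2F) (neg (mem 0F 3F) & neg (mem 0F 2F))))))))

module _ {M : ℕ} where
  open Semantics Bit M

  tower-sound : ∀ {n} j (x : Fin n) {ρ} → Bounded M ρ → Holds (tower j x) ρ → lookup ρ x ≡ tow j
  tower-sound zero    x {ρ} b h = isZero-sound {Bit} {M} x ρ h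
  tower-sound (suc j) x {ρ} b (y , y≤ , t , y∈x , least)
    with tower-sound j 0F (bounded-∷ y≤ b) t
  -- Minimality may be applied to 2^y, as 2^y ≤ x ≤ M.
  ... | refl with least (2 ^ y) (ℕₚ.≤-trans (Bit⇒2^≤ y∈x) (b .bound x))
  ...   | inj₁ y∉ = ⊥-elim (y∉ (Bit-2^ y))
  ...   | inj₂ x≤ = ℕₚ.≤-antisym x≤ (Bit⇒2^≤ y∈x)

  tower-complete : ∀ {n} j (x : Fin n) {ρ} → lookup ρ x ≡ tow j → tow j ≤ M → Holds (tower j x) ρ
  tower-complete zero    x {ρ} e _ = isZero-complete {Bit} {M} x ρ e
  tower-complete (suc j) x {ρ} e t≤ =
    tow j , tow≤M , tower-complete j 0F refl tow≤M , subst (Bit (tow j)) (sym e) (Bit-2^ (tow j)) ,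
    least
    where
    tow≤M : tow j ≤ M
    tow≤M = ℕₚ.≤-trans (ℕₚ.<⇒≤ (n<2^n (tow j))) t≤
    least : ∀ z → z ≤ M → ¬ Bit (tow j) z ⊎ lookup ρ x ≤ z
    least z _ with T? (digit (digits z) (tow j))
    ... | yes t∈z = inj₂ (ℕₚ.≤-trans (ℕₚ.≤-reflexive e) (Bit⇒2^≤ t∈z))
    ... | no  t∉z = inj₁ t∉z

  -- The value of the coded computation is a quantified element and so at most M; determinism
  -- identifies it with y.
  goal-sound : ∀ {c j y} → Eval c (tow j ∷ []) y → Holds (goal c j) [] → y ≤ M
  goal-sound {c} {j} d (x , x≤ , t , y , y≤ , h)
    with tower-sound j 0F (bounded-∷ x≤ bounded-[]) t
  ... | refl = subst (_≤ M)
    (eval-deterministic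
      (graph-sound {Bit} c (reads λ { zero → refl }) (bounded-∷ y≤ (bounded-∷ x≤ bounded-[])) h) d)
    y≤

  bitRule-holds : Holds bitRule []
  bitRule-holds = empty , step
    where
    empty : ∀ x → x ≤ M → ¬ Holds (isZero 0F) (x ∷ []) ⊎ (∀ i → i ≤ M → ¬ Bit i x)
    empty zero    _ = inj₂ λ i _ → ¬Bit-zero i
    empty (suc x) _ = inj₁ λ h → ℕₚ.1+n≢0 (isZero-sound {Bit} {M} 0F (suc x ∷ []) h)
    step : ∀ x → x ≤ M → ∀ y → y ≤ M → _
    step x x≤ y y≤ with y ℕ.≟ suc x
    ... | no ≢ = inj₁ λ h →
      ≢ (isSuc-sound {Bit} {M} 1F 0F (bounded-∷ y≤ (bounded-∷ x≤ bounded-[])) h)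
    ... | yes refl = inj₂
      ( carry l , ℕₚ.≤-trans (ℕₚ.<⇒≤ (Bit⇒< (carry∈increment l))) y≤
      , carry∉ l , carry∈increment l
      , λ i _ → Sum.map id (below-carry l) (ℕₚ.≤-<-connex (carry l) i)
              , Sum.map id above (ℕₚ.≤-<-connex i (carry l)))
      where
      l = digits x
      above : ∀ {i} → carry l < i →
              (Bit i x × Bit i (suc x)) ⊎ (¬ Bit i x × ¬ Bit i (suc x))
      above {i} p with digit l i | digit (increment l) i | above-carry l p
      ... | true  | _ | refl = inj₁ (tt , tt)
      ... | false | _ | refl = inj₂ (id , id)

goal-complete : ∀ {c j y} → Eval c (tow j ∷ []) y → ∃ λ M → Semantics.Holds Bit M (goal c j) []
goal-complete {c} {j} {y} d with graph-complete d
... | T , q = M , tow j , t≤ , tower-complete j 0F refl t≤ , y , y≤ ,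
              q T≤ (y ∷ tow j ∷ []) (λ _ → 1F) 0F (reads λ { zero → refl }) refl
  where
  M = T ⊔ (tow j ⊔ y)
  T≤ : T ≤ M
  T≤ = ℕₚ.m≤m⊔n T _
  t≤ : tow j ≤ M
  t≤ = ℕₚ.≤-trans (ℕₚ.m≤m⊔n (tow j) y) (ℕₚ.m≤n⊔m T _)
  y≤ : y ≤ M
  y≤ = ℕₚ.≤-trans (ℕₚ.m≤n⊔m (tow j) y) (ℕₚ.m≤n⊔m T _)

-- By induction on j. The position b given by the rule is not a bit of j while everything below b
-- is, so b is where the carry stops, and the rule then dictates all the bits of j + 1.
bitRule-unique : ∀ {R M} → Semantics.Holds R M bitRule [] →
                 ∀ j → j ≤ M → ∀ i → i ≤ M → R i j ⇔ Bit i j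
bitRule-unique {R} {M} (empty , step) zero _ i i≤ with empty 0 z≤n
... | inj₁ ¬z = ⊥-elim (¬z (isZero-complete {R} {M} 0F (0 ∷ []) refl))
... | inj₂ none = mk⇔ (none i i≤) λ ()
bitRule-unique {R} {M} h@(empty , step) (suc j) j<M i i≤ with step j (ℕₚ.<⇒≤ j<M) (suc j) j<M
... | inj₁ ¬s = ⊥-elim (¬s (isSuc-complete {R} {M} 1F 0F (suc j ∷ j ∷ []) refl))
... | inj₂ (b , b≤ , b∉ , b∈ , rest) = result
  where
  l = digits j
  ih : ∀ i → i ≤ M → R i j ⇔ Bit i j
  ih = bitRule-unique h j (ℕₚ.<⇒≤ j<M)
  carry≤M : carry l ≤ M
  carry≤M = ℕₚ.≤-trans (ℕₚ.<⇒≤ (Bit⇒< {n = suc j} (carry∈increment l))) j<M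
  b≡carry : b ≡ carry l
  b≡carry with ℕₚ.<-cmp b (carry l)
  ... | tri≈ _ e _ = e
  ... | tri< p _ _ = ⊥-elim (b∉ (from (ih b b≤) (proj₁ (below-carry l p))))
  ... | tri> _ _ p with proj₁ (rest (carry l) carry≤M)
  ...   | inj₁ b≤c     = ⊥-elim (ℕₚ.<⇒≱ p b≤c)
  ...   | inj₂ (c∈ , _) = ⊥-elim (carry∉ l (to (ih (carry l) carry≤M) c∈))
  result : R i (suc j) ⇔ Bit i (suc j)
  result with ℕₚ.<-cmp i (carry l) | rest i i≤
  ... | tri≈ _ refl _ | _ = mk⇔ (λ _ → carry∈increment l) (λ _ → subst (λ b → R b (suc j)) b≡carry b∈)
  ... | tri< p _ _ | inj₁ b≤i , _ = ⊥-elim (ℕₚ.<⇒≱ p (subst (_≤ i) b≡carry b≤i))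
  ... | tri< p _ _ | inj₂ (_ , i∉) , _ = mk⇔ (⊥-elim ∘ i∉) (⊥-elim ∘ proj₂ (below-carry l p))
  ... | tri> _ _ p | _ , inj₁ i≤b = ⊥-elim (ℕₚ.<⇒≱ p (subst (i ≤_) b≡carry i≤b))
  ... | tri> _ _ p | _ , inj₂ (inj₁ (i∈ , i∈')) =
    mk⇔ (λ _ → subst T (sym (above-carry l p)) (to (ih i i≤) i∈)) (λ _ → i∈')
  ... | tri> _ _ p | _ , inj₂ (inj₂ (i∉ , i∉')) =
    mk⇔ (⊥-elim ∘ i∉') (λ t → ⊥-elim (i∉ (from (ih i i≤) (subst T (above-carry l p) t))))


-- Numbers and their order inside a graph.

record Triple (A : Set) : Set where
  constructor ⟨_,_,_⟩
  field fst₃ snd₃ trd₃ : A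
open Triple

map₃ : ∀ {A B} → (A → B) → Triple A → Triple B
map₃ f ⟨ x , y , z ⟩ = ⟨ f x , f y , f z ⟩

-- The induced subgraph that makes a triple of vertices a number relative to the three
-- parameters.  It is chosen such that in the coding graphs below only the intended triples
-- qualify, whatever the parameters are.
shape : ∀ {ℓ} {X : Set ℓ} {V : Set} (_⊗_ : X → X → X) (edge nonedge : V → V → X)
        (k t : Triple V) → X
shape _⊗_ e n ⟨ k₀ , k₁ , k₂ ⟩ ⟨ a , b , c ⟩ =
  e a b ⊗ (e b c ⊗ (e c a ⊗
  (e a k₁ ⊗ (e a k₂ ⊗ (e b k₀ ⊗ (e c k₀ ⊗ (e c k₁ ⊗ (e c k₂ ⊗ (e k₁ k₂ ⊗
  (n a k₀ ⊗ (n b k₁ ⊗ (n b k₂ ⊗ (n k₀ k₁ ⊗ n k₀ k₂)))))))))))))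

shape-map : ∀ {V V' : Set} (P Q : V → V → Set) (P' Q' : V' → V' → Set) (f : V → V') →
  (∀ u v → P u v → P' (f u) (f v)) → (∀ u v → Q u v → Q' (f u) (f v)) →
  ∀ k t → shape _×_ P Q k t → shape _×_ P' Q' (map₃ f k) (map₃ f t)
shape-map P Q P' Q' f p q k t (x₁ , x₂ , x₃ , x₄ , x₅ , x₆ , x₇ , x₈ , x₉ , x₁₀ , y₁ , y₂ , y₃ , y₄ , y₅) =
  p _ _ x₁ , p _ _ x₂ , p _ _ x₃ , p _ _ x₄ , p _ _ x₅ , p _ _ x₆ , p _ _ x₇ , p _ _ x₈ ,
  p _ _ x₉ , p _ _ x₁₀ , q _ _ y₁ , q _ _ y₂ , q _ _ y₃ , q _ _ y₄ , q _ _ y₅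

Edge : (G : FinGraph) → Vertex G → Vertex G → Set
Edge G u v = T (adj G u v)

module _ (G : FinGraph) where

  IsNumber : (k t : Triple (Vertex G)) → Set
  IsNumber = shape _×_ (Edge G) (λ u v → ¬ Edge G u v)

  Leq Step Memb : (t u : Triple (Vertex G)) → Set
  Leq  t u = Edge G (snd₃ t) (trd₃ u)
  Step t u = Edge G (trd₃ t) (fst₃ u)
  -- Components a and b of one number are adjacent too; strictness keeps this edge from counting as
  -- membership.
  Memb t u = Edge G (fst₃ t) (snd₃ u) × ¬ Leq u t

  -- Failures of totality, transitivity and antisymmetry, and a number strictly between x and its
  -- successor y.
  Bad : (x y z : Triple (Vertex G)) → Set
  Bad x y z =
      (¬ Leq x y × ¬ Leq y x)
    ⊎ (Leq x y × Leq y z × ¬ Leq x z)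
    ⊎ (Leq x y × Leq y x × ¬ (fst₃ x ≡ fst₃ y × snd₃ x ≡ snd₃ y × trd₃ x ≡ trd₃ y))
    ⊎ (Step x y × Leq x z × Leq z y × ¬ Leq z x × ¬ Leq y z)

  -- Imposed for all choices of the parameters k, since `hasModel` may pick any of them.
  Ordered : Set
  Ordered = ∀ k x y z → ¬ (IsNumber k x × IsNumber k y × IsNumber k z × Bad x y z)

  InSegment : (k lo hi t : Triple (Vertex G)) → Set
  InSegment k lo hi t = IsNumber k t × Leq lo t × Leq t hi

  Connected : (k lo hi : Triple (Vertex G)) → Set
  Connected k lo hi = ∀ t → InSegment k lo hi t →
    -- Every number is a `Step` from itself, so strictness is what makes u a proper successor.
    Leq hi t ⊎ ∃ λ u → InSegment k lo hi u × Step t u × ¬ Leq u t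

numberF : ∀ {n} (k t : Triple (Fin n)) → Formula n
numberF = shape _∧'_ E λ u v → ¬' (E u v)

leqF stepF membF : ∀ {n} (t u : Triple (Fin n)) → Formula n
leqF t u  = E (snd₃ t) (trd₃ u)
stepF t u = E (trd₃ t) (fst₃ u)
membF t u = E (fst₃ t) (snd₃ u) ∧' ¬' (leqF u t)

badF : ∀ {n} (x y z : Triple (Fin n)) → Formula n
badF x y z =
     (¬' (leqF x y) ∧' ¬' (leqF y x))
  ∨' ((leqF x y ∧' (leqF y z ∧' ¬' (leqF x z)))
  ∨' ((leqF x y ∧' (leqF y x ∧'
        ¬' ((fst₃ x ≐ fst₃ y) ∧' ((snd₃ x ≐ snd₃ y) ∧' (trd₃ x ≐ trd₃ y)))))
  ∨' (stepF x y ∧' (leqF x z ∧' (leqF z y ∧' (¬' (leqF z x) ∧' ¬' (leqF y z)))))))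

∀³ ∃³ : ∀ {n} → Formula (3 + n) → Formula n
∀³ φ = ∀' (∀' (∀' φ))
∃³ φ = ∃' (∃' (∃' φ))

orderAxioms : Sentence
orderAxioms = ∀³ (∀³ (∀³ (∀³ (¬' (numberF k x ∧' (numberF k y ∧' (numberF k z ∧' badF x y z)))))))
  where
  k x y z : Triple (Fin 12)
  k = map₃ (9 ↑ʳ_) ⟨ 2F , 1F , 0F ⟩
  x = ⟨ 8F , 7F , 6F ⟩
  y = ⟨ 5F , 4F , 3F ⟩
  z = ⟨ 2F , 1F , 0F ⟩

orderAxioms-univ : Univ orderAxioms
orderAxioms-univ = all (all (all (all (all (all (all (all (all (all (all (all (qf _))))))))))))

orderAxioms⇒Ordered : ∀ {G} → G ⊨ orderAxioms → Ordered G
orderAxioms⇒Ordered h ⟨ k₀ , k₁ , k₂ ⟩ ⟨ xa , xb , xc ⟩ ⟨ ya , yb , yc ⟩ ⟨ za , zb , zc ⟩ =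
  h k₀ k₁ k₂ xa xb xc ya yb yc za zb zc

Ordered⇒orderAxioms : ∀ {G} → Ordered G → G ⊨ orderAxioms
Ordered⇒orderAxioms h k₀ k₁ k₂ xa xb xc ya yb yc za zb zc =
  h ⟨ k₀ , k₁ , k₂ ⟩ ⟨ xa , xb , xc ⟩ ⟨ ya , yb , yc ⟩ ⟨ za , zb , zc ⟩

module Order {G : FinGraph} (ordered : Ordered G) {k : Triple (Vertex G)} where

  private
    N   = IsNumber G k
    _≼_ = Leq G

  leq? : ∀ t u → Dec (t ≼ u)
  leq? t u = T? _

  reflexive : ∀ {t} → N t → t ≼ t
  reflexive (_ , bc , _) = bc

  total : ∀ {t u} → N t → N u → ¬ t ≼ u → u ≼ t
  total {t} {u} p q ≰ = decidable-stable (leq? u t) λ ≱ → ordered k t u t (p , q , p , inj₁ (≰ , ≱))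

  transitive : ∀ {t u v} → N t → N u → N v → t ≼ u → u ≼ v → t ≼ v
  transitive {t} {u} {v} p q r x y = decidable-stable (leq? t v) λ z →
    ordered k t u v (p , q , r , inj₂ (inj₁ (x , y , z)))

  antisymmetric : ∀ {t u} → N t → N u → t ≼ u → u ≼ t → t ≡ u
  antisymmetric {t} {u} p q x y
    with fst₃ t Finₚ.≟ fst₃ u | snd₃ t Finₚ.≟ snd₃ u | trd₃ t Finₚ.≟ trd₃ u
       | (λ ≢ → ordered k t u t (p , q , p , inj₂ (inj₂ (inj₁ (x , y , ≢)))))
  ... | yes refl | yes refl | yes refl | _ = refl
  ... | no ≢ | _ | _ | differ = ⊥-elim (differ λ (e , _) → ≢ e)
  ... | _ | no ≢ | _ | differ = ⊥-elim (differ λ (_ , e , _) → ≢ e)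
  ... | _ | _ | no ≢ | differ = ⊥-elim (differ λ (_ , _ , e) → ≢ e)

  no-gap : ∀ {t u v} → N t → N u → N v → Step G t u → t ≼ v → v ≼ u → ¬ v ≼ t → u ≼ v
  no-gap {t} {u} {v} p q r s x y z = decidable-stable (leq? u v) λ w →
    ordered k t u v (p , q , r , inj₂ (inj₂ (inj₂ (s , x , y , z , w))))

-- A copy of {0,...,M}; only the values of e up to M count. The conditions mention no vertices
-- besides the parameters and these values, so they pass both ways along embeddings, unlike
-- `Connected`, which quantifies over all of G.
record Segment (G : FinGraph) (k : Triple (Vertex G)) (M : ℕ) (e : ℕ → Triple (Vertex G)) : Set where
  field
    number : ∀ {i} → i ≤ M → IsNumber G k (e i)
    leq⇔≤  : ∀ {i j} → i ≤ M → j ≤ M → Leq G (e i) (e j) ⇔ i ≤ j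
    step   : ∀ {i} → i < M → Step G (e i) (e (suc i))
open Segment

module _ {G : FinGraph} {k : Triple (Vertex G)} {M : ℕ} {e : ℕ → Triple (Vertex G)}
         (seg : Segment G k M e) where

  -- The second component alone fixes the position, for the order is read off the edges from it to
  -- third components.
  segment-injective : ∀ {i j} → i ≤ M → j ≤ M → snd₃ (e i) ≡ snd₃ (e j) → i ≡ j
  segment-injective i≤ j≤ eq = ℕₚ.≤-antisym (below i≤ j≤ (sym eq)) (below j≤ i≤ eq)
    where
    below : ∀ {i j} → i ≤ M → j ≤ M → snd₃ (e j) ≡ snd₃ (e i) → i ≤ j
    below {i} {j} i≤ j≤ eq = to (leq⇔≤ seg i≤ j≤)
      (subst (λ b → Edge G b (trd₃ (e j))) eq (proj₁ (proj₂ (number seg j≤))))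

  segment-size : suc M ≤ size G
  segment-size = Finₚ.injective⇒≤ {f = λ (i : Fin (suc M)) → snd₃ (e (toℕ i))} λ {i} {j} eq →
    Finₚ.toℕ-injective (segment-injective (Finₚ.toℕ≤pred[n] i) (Finₚ.toℕ≤pred[n] j) eq)

  module _ (ordered : Ordered G) where
    open Order {G} ordered {k}

    -- Descending from M: a number that is ≤ e (i + 1) but not ≤ e i can only be e (i + 1), by
    -- `no-gap`. Hence no larger ordered graph inserts numbers into a segment.
    segment-onto : ∀ {t} → IsNumber G k t → Leq G (e 0) t → Leq G t (e M) →
                   ∃ λ i → i ≤ M × t ≡ e i
    segment-onto {t} n lo = below M ℕₚ.≤-refl
      where
      below : ∀ i → i ≤ M → Leq G t (e i) → ∃ λ i → i ≤ M × t ≡ e i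
      below zero    i≤ hi = 0 , i≤ , antisymmetric n (number seg i≤) hi lo
      below (suc i) i< hi with leq? t (e i)
      ... | yes p = below i (ℕₚ.<⇒≤ i<) p
      ... | no ¬p = suc i , i< , antisymmetric n nᵢ₊₁ hi
                      (no-gap nᵢ nᵢ₊₁ n (step seg i<) (total n nᵢ ¬p) hi ¬p)
        where
        nᵢ   = number seg (ℕₚ.<⇒≤ i<)
        nᵢ₊₁ = number seg i<

chain⇒segment : ∀ {G k M e} → Ordered G → (∀ {i} → i ≤ M → IsNumber G k (e i)) →
  (∀ {i} → i < M → Step G (e i) (e (suc i)) × ¬ Leq G (e (suc i)) (e i)) → Segment G k M e
chain⇒segment {G} {k} {M} {e} ordered n chain = record
  { number = n
  ; leq⇔≤  = λ i≤ j≤ → mk⇔ (reflects i≤ j≤) (λ i≤j → mono i≤j j≤)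
  ; step   = proj₁ ∘ chain
  }
  where
  open Order {G} ordered {k}
  mono : ∀ {i j} → i ≤ j → j ≤ M → Leq G (e i) (e j)
  mono {i} {j} i≤j j≤ with ℕₚ.m≤n⇒m<n∨m≡n i≤j
  ... | inj₂ refl = reflexive (n j≤)
  mono {i} {suc j} i≤j j< | inj₁ (s≤s i≤j') =
    transitive (n (ℕₚ.≤-trans i≤j j<)) (n (ℕₚ.<⇒≤ j<)) (n j<) (mono i≤j' (ℕₚ.<⇒≤ j<))
      (total (n j<) (n (ℕₚ.<⇒≤ j<)) (proj₂ (chain j<)))
  reflects : ∀ {i j} → i ≤ M → j ≤ M → Leq G (e i) (e j) → i ≤ j
  reflects {i} {j} i≤ j≤ p with ℕₚ.≤-<-connex i j
  ... | inj₁ i≤j = i≤j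
  ... | inj₂ j<i = ⊥-elim (proj₂ (chain (ℕₚ.≤-trans j<i i≤))
    (transitive (n (ℕₚ.≤-trans j<i i≤)) (n i≤) (n j≤) (mono j<i i≤) p))

least : ∀ {P : ℕ → Set} → (∀ i → Dec (P i)) → ∀ n →
        (∃ λ m → P m × (∀ {i} → i < m → ¬ P i)) ⊎ (∀ {i} → i < n → ¬ P i)
least P? zero = inj₂ λ ()
least P? (suc n) with least P? n
... | inj₁ found = inj₁ found
... | inj₂ none with P? n
...   | yes p = inj₁ (n , p , none)
...   | no ¬p = inj₂ λ i<1+n → Sum.[ none , (λ { refl → ¬p }) ] (ℕₚ.m<1+n⇒m<n∨m≡n i<1+n)

-- Following the successor steps upwards from lo reaches hi, since G is finite.
connected⇒segment : ∀ {G k lo hi} → Ordered G → IsNumber G k lo → IsNumber G k hi → Leq G lo hi →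
  Connected G k lo hi → ∃₂ λ M e → e 0 ≡ lo × e M ≡ hi × Segment G k M e
connected⇒segment {G} {k} {lo} {hi} ordered nlo nhi lo≤hi connected = result
  where
  open Order {G} ordered {k}
  P : Set
  P = ∃ (InSegment G k lo hi)
  next : P → P
  -- At or above hi the walk stays put; strict ascent is used only before that point.
  next p@(t , s) with leq? hi t
  ... | yes _ = p
  ... | no ≰ with connected t s
  ...   | inj₁ q = p
  ...   | inj₂ (u , q , _) = u , q
  next-chain : ∀ p → ¬ Leq G hi (proj₁ p) →
    Step G (proj₁ p) (proj₁ (next p)) × ¬ Leq G (proj₁ (next p)) (proj₁ p)
  next-chain (t , s) ≰ with leq? hi t
  ... | yes q = ⊥-elim (≰ q)
  ... | no _ with connected t s
  ...   | inj₁ q = ⊥-elim (≰ q)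
  ...   | inj₂ (_ , _ , r) = r
  walk : ℕ → P
  walk zero    = lo , nlo , reflexive nlo , lo≤hi
  walk (suc i) = next (walk i)
  e : ℕ → Triple (Vertex G)
  e i = proj₁ (walk i)
  segment : ∀ M → (∀ {i} → i < M → ¬ Leq G hi (e i)) → Segment G k M e
  segment M none = chain⇒segment ordered (λ {i} _ → proj₁ (proj₂ (walk i)))
    (λ {i} i<M → next-chain (walk i) (none i<M))
  result : ∃₂ λ M e → e 0 ≡ lo × e M ≡ hi × Segment G k M e
  result with least (λ i → leq? hi (e i)) (size G)
  -- `size G` strict steps would visit one number more than G has vertices.
  ... | inj₂ none = ⊥-elim (ℕₚ.1+n≰n (segment-size (segment (size G) none)))
  ... | inj₁ (M , p , none) =
    let _ , nM , _ , M≤hi = walk M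
    in M , e , refl , antisymmetric nM nhi M≤hi p , segment M none

-- Translation of arithmetic into the language of graphs.

record Frame (V : Set) : Set where
  constructor frame
  field params lower upper : Triple V
open Frame

mapFrame : ∀ {V W} → (V → W) → Frame V → Frame W
mapFrame f (frame k lo hi) = frame (map₃ f k) (map₃ f lo) (map₃ f hi)

inSegmentF : ∀ {n} → Frame (Fin n) → Triple (Fin n) → Formula n
inSegmentF (frame k lo hi) t = numberF k t ∧' (leqF lo t ∧' leqF t hi)

newest : ∀ {n} → Triple (Fin (3 + n))
newest = ⟨ 2F , 1F , 0F ⟩

extend : ∀ {m n} → (Fin m → Triple (Fin n)) → Fin (suc m) → Triple (Fin (3 + n))
extend σ zero    = newest
extend σ (suc i) = map₃ (3 ↑ʳ_) (σ i)

-- Relativization to the interval of F, with three vertex variables for each number variable.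
interpret : ∀ {m n} → Frame (Fin n) → (Fin m → Triple (Fin n)) → Arith m → Formula n
interpret F σ (le x y)   = leqF (σ x) (σ y)
interpret F σ (mem x y)  = membF (σ x) (σ y)
interpret F σ (neg ψ)    = ¬' (interpret F σ ψ)
interpret F σ (conj ψ χ) = interpret F σ ψ ∧' interpret F σ χ
interpret F σ (alt ψ χ)  = interpret F σ ψ ∨' interpret F σ χ
interpret F σ (all ψ)    = ∀³ (¬' (inSegmentF F' newest) ∨' interpret F' (extend σ) ψ)
  where F' = mapFrame (3 ↑ʳ_) F
interpret F σ (ex ψ)     = ∃³ (inSegmentF F' newest ∧' interpret F' (extend σ) ψ)
  where F' = mapFrame (3 ↑ʳ_) F

module _ {G : FinGraph} {k : Triple (Vertex G)} {M : ℕ} {e : ℕ → Triple (Vertex G)}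
         (ordered : Ordered G) (seg : Segment G k M e)
         {R : ℕ → ℕ → Set} (agree : ∀ {i j} → i ≤ M → j ≤ M → Memb G (e i) (e j) ⇔ R i j) where
  open Semantics R M

  private
    Within : Triple (Vertex G) → Frame (Vertex G) → Set
    Within t (frame k lo hi) = InSegment G k lo hi t

    within : ∀ {z} → z ≤ M → Within (e z) (frame k (e 0) (e M))
    within z≤ = number seg z≤ , from (leq⇔≤ seg z≤n z≤) z≤n , from (leq⇔≤ seg z≤ ℕₚ.≤-refl) z≤

  instance-correct : ∀ {m n} (ψ : Arith (suc m)) (F : Frame (Fin n)) σ ρ xs →
    mapFrame (lookup ρ) F ≡ frame k (e 0) (e M) →
    (∀ i → map₃ (lookup ρ) (σ i) ≡ e (lookup xs i)) → Bounded M xs →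
    ∀ {t z} → z ≤ M → t ≡ e z →
    Sat G (interpret (mapFrame (3 ↑ʳ_) F) (extend σ) ψ) (trd₃ t ∷ snd₃ t ∷ fst₃ t ∷ ρ)
      ⇔ Holds ψ (z ∷ xs)

  -- The relativized quantifiers range exactly over e 0, ..., e M, by `segment-onto`.
  interpret-correct : ∀ {m n} (ψ : Arith m) (F : Frame (Fin n)) σ ρ xs →
    mapFrame (lookup ρ) F ≡ frame k (e 0) (e M) →
    (∀ i → map₃ (lookup ρ) (σ i) ≡ e (lookup xs i)) → Bounded M xs →
    Sat G (interpret F σ ψ) ρ ⇔ Holds ψ xs
  interpret-correct (le x y) F σ ρ xs eF eσ b =
    let eq = subst₂ (Leq G) (eσ x) (eσ y) ; qe = subst₂ (Leq G) (sym (eσ x)) (sym (eσ y))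
        l  = leq⇔≤ seg (b .bound x) (b .bound y)
    in mk⇔ (to l ∘ eq) (qe ∘ from l)
  interpret-correct (mem x y) F σ ρ xs eF eσ b =
    let eq = subst₂ (Memb G) (eσ x) (eσ y) ; qe = subst₂ (Memb G) (sym (eσ x)) (sym (eσ y))
        l  = agree (b .bound x) (b .bound y)
    in mk⇔ (to l ∘ eq) (qe ∘ from l)
  interpret-correct (neg ψ) F σ ρ xs eF eσ b =
    let ih = interpret-correct ψ F σ ρ xs eF eσ b in mk⇔ (_∘ from ih) (_∘ to ih)
  interpret-correct (conj ψ χ) F σ ρ xs eF eσ b =
    let ih = interpret-correct ψ F σ ρ xs eF eσ b ; ih' = interpret-correct χ F σ ρ xs eF eσ b
    in mk⇔ (Product.map (to ih) (to ih')) (Product.map (from ih) (from ih'))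
  interpret-correct (alt ψ χ) F σ ρ xs eF eσ b =
    let ih = interpret-correct ψ F σ ρ xs eF eσ b ; ih' = interpret-correct χ F σ ρ xs eF eσ b
    in mk⇔ (Sum.map (to ih) (to ih')) (Sum.map (from ih) (from ih'))
  interpret-correct (all ψ) F σ ρ xs eF eσ b = mk⇔ forth back
    where
    forth : Sat G (interpret F σ (all ψ)) ρ → Holds (all ψ) xs
    forth h z z≤ with h (fst₃ (e z)) (snd₃ (e z)) (trd₃ (e z))
    ... | inj₁ out = ⊥-elim (out (subst (Within (e z)) (sym eF) (within z≤)))
    ... | inj₂ s   = to (instance-correct ψ F σ ρ xs eF eσ b z≤ refl) s
    back : Holds (all ψ) xs → Sat G (interpret F σ (all ψ)) ρ
    back h x y w with sat? G (inSegmentF (mapFrame (3 ↑ʳ_) F) newest) (w ∷ y ∷ x ∷ ρ)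
    ... | no out = inj₁ out
    ... | yes s with subst (Within ⟨ x , y , w ⟩) eF s
    ...   | num , l , u with segment-onto seg ordered num l u
    ...     | z , z≤ , eq = inj₂ (from (instance-correct ψ F σ ρ xs eF eσ b z≤ eq) (h z z≤))
  interpret-correct (ex ψ) F σ ρ xs eF eσ b = mk⇔ forth back
    where
    forth : Sat G (interpret F σ (ex ψ)) ρ → Holds (ex ψ) xs
    forth (x , y , w , s , h) with subst (Within ⟨ x , y , w ⟩) eF s
    ... | num , l , u with segment-onto seg ordered num l u
    ...   | z , z≤ , eq = z , z≤ , to (instance-correct ψ F σ ρ xs eF eσ b z≤ eq) h
    back : Holds (ex ψ) xs → Sat G (interpret F σ (ex ψ)) ρ
    back (z , z≤ , h) = _ , _ , _ , subst (Within (e z)) (sym eF) (within z≤) ,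
      from (instance-correct ψ F σ ρ xs eF eσ b z≤ refl) h

  instance-correct ψ F σ ρ xs eF eσ b {z = z} z≤ eq =
    interpret-correct ψ _ (extend σ) _ (z ∷ xs) eF (λ { zero → eq ; (suc i) → eσ i })
      (bounded-∷ z≤ b)

connectedF : ∀ {n} → Frame (Fin n) → Formula n
connectedF F = ∀³ (¬' (inSegmentF F' newest) ∨' (leqF (upper F') newest ∨'
  ∃³ (inSegmentF F″ newest ∧' (stepF (map₃ (3 ↑ʳ_) newest) newest
    ∧' ¬' (leqF newest (map₃ (3 ↑ʳ_) newest))))))
  where
  F' = mapFrame (3 ↑ʳ_) F
  F″ = mapFrame (3 ↑ʳ_) F'

outerFrame : Frame (Fin 9)
outerFrame = frame ⟨ 8F , 7F , 6F ⟩ ⟨ 5F , 4F , 3F ⟩ ⟨ 2F , 1F , 0F ⟩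

assign : ∀ {V} → Frame V → Vec V 9
assign (frame ⟨ k₀ , k₁ , k₂ ⟩ ⟨ l₀ , l₁ , l₂ ⟩ ⟨ h₀ , h₁ , h₂ ⟩) =
  h₂ ∷ h₁ ∷ h₀ ∷ l₂ ∷ l₁ ∷ l₀ ∷ k₂ ∷ k₁ ∷ k₀ ∷ []

noTriples : ∀ {n} → Fin 0 → Triple (Fin n)
noTriples ()

-- Meant for ordered graphs, where `connectedF` makes the interval from lo to hi a copy of some
-- {0,...,M}.
hasModel : Arith 0 → Sentence
hasModel ψ = ∃³ (∃³ (∃³
  (numberF k lo ∧' (numberF k hi ∧' (leqF lo hi ∧'
    (connectedF outerFrame ∧' interpret outerFrame noTriples (bitRule & ψ)))))))
  where
  k lo hi : Triple (Fin 9)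
  k  = params outerFrame
  lo = lower outerFrame
  hi = upper outerFrame

record Model (G : FinGraph) (k : Triple (Vertex G)) (M : ℕ) (e : ℕ → Triple (Vertex G)) : Set where
  field
    segment : Segment G k M e
    bits    : ∀ {i j} → i ≤ M → j ≤ M → Memb G (e i) (e j) ⇔ Bit i j
open Model

ModelOf : Arith 0 → FinGraph → Set
ModelOf ψ G = ∃ λ k → ∃₂ λ M e → Model G k M e × Semantics.Holds Bit M ψ []

-- From left to right, `bitRule` is first evaluated with the membership relation that G happens to
-- define; `bitRule-unique` identifies this relation with `Bit`, and only then is ψ evaluated.
hasModel⇔ModelOf : ∀ {G} ψ → Ordered G → (G ⊨ hasModel ψ) ⇔ ModelOf ψ G
hasModel⇔ModelOf {G} ψ ordered = mk⇔ forth back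
  where
  forth : G ⊨ hasModel ψ → ModelOf ψ G
  forth (k₀ , k₁ , k₂ , l₀ , l₁ , l₂ , h₀ , h₁ , h₂ , nlo , nhi , l≤h , con , s) = result
    where
    k  = ⟨ k₀ , k₁ , k₂ ⟩
    lo = ⟨ l₀ , l₁ , l₂ ⟩
    hi = ⟨ h₀ , h₁ , h₂ ⟩
    connected : Connected G k lo hi
    connected ⟨ a , b , c ⟩ inSeg with con a b c
    ... | inj₁ out      = ⊥-elim (out inSeg)
    ... | inj₂ (inj₁ p) = inj₁ p
    ... | inj₂ (inj₂ (a' , b' , c' , q)) = inj₂ (⟨ a' , b' , c' ⟩ , q)
    result : ModelOf ψ G
    result with connected⇒segment {G} {k} {lo} {hi} ordered nlo nhi l≤h connected
    ... | M , e , refl , refl , seg = k , M , e , model , to (correct agree ψ) (proj₂ s)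
      where
      correct : ∀ {R : ℕ → ℕ → Set} →
        (∀ {i j} → i ≤ M → j ≤ M → Memb G (e i) (e j) ⇔ R i j) → (ψ : Arith 0) →
        Sat G (interpret outerFrame noTriples ψ) (assign (frame k (e 0) (e M)))
          ⇔ Semantics.Holds R M ψ []
      correct agree ψ = interpret-correct ordered seg agree ψ outerFrame noTriples
        (assign (frame k (e 0) (e M))) [] refl (λ ()) bounded-[]
      agree : ∀ {i j} → i ≤ M → j ≤ M → Memb G (e i) (e j) ⇔ Bit i j
      agree {i} {j} i≤ j≤ =
        bitRule-unique (to (correct (λ _ _ → mk⇔ id id) bitRule) (proj₁ s)) j j≤ i i≤
      model : Model G k M e
      model = record { segment = seg ; bits = agree }
  back : ModelOf ψ G → G ⊨ hasModel ψ
  back (k , M , e , model , h) =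
    _ , _ , _ , _ , _ , _ , _ , _ , _ ,
    number seg z≤n , number seg ℕₚ.≤-refl , from (leq⇔≤ seg z≤n ℕₚ.≤-refl) z≤n , con ,
    from (interpret-correct ordered seg (bits model) (bitRule & ψ) outerFrame noTriples ρ []
           refl (λ ()) bounded-[])
      (bitRule-holds , h)
    where
    seg = segment model
    ρ : Vec (Vertex G) 9
    ρ = assign (frame k (e 0) (e M))
    con : Sat G (connectedF outerFrame) ρ
    con a b c with sat? G (inSegmentF (mapFrame (3 ↑ʳ_) outerFrame) newest) (c ∷ b ∷ a ∷ ρ)
    ... | no out = inj₁ out
    ... | yes (n , lo , hi) with segment-onto seg ordered n lo hi
    ...   | i , i≤ , refl with ℕₚ.m≤n⇒m<n∨m≡n i≤
    ...     | inj₂ refl = inj₂ (inj₁ (from (leq⇔≤ seg i≤ i≤) ℕₚ.≤-refl))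
    ...     | inj₁ i<   = inj₂ (inj₂ (_ , _ , _ ,
      (number seg i< , from (leq⇔≤ seg z≤n i<) z≤n , from (leq⇔≤ seg i< ℕₚ.≤-refl) i<) ,
      step seg i< , λ p → ℕₚ.1+n≰n (to (leq⇔≤ seg i< i≤) p)))

-- Models along embeddings.

module _ {H G : FinGraph} (ι : H ↪ G) where

  edge⇔ : ∀ u v → Edge H u v ⇔ Edge G (fn ι u) (fn ι v)
  edge⇔ u v = mk⇔ (subst T (fn-adj ι u v)) (subst T (sym (fn-adj ι u v)))

  nonedge⇔ : ∀ u v → (¬ Edge H u v) ⇔ (¬ Edge G (fn ι u) (fn ι v))
  nonedge⇔ u v = mk⇔ (_∘ from (edge⇔ u v)) (_∘ to (edge⇔ u v))

  isNumber⇔ : ∀ k t → IsNumber H k t ⇔ IsNumber G (map₃ (fn ι) k) (map₃ (fn ι) t)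
  isNumber⇔ k t = mk⇔
    (shape-map (Edge H) (λ u v → ¬ Edge H u v) (Edge G) (λ u v → ¬ Edge G u v)
      (fn ι) (λ u v → to (edge⇔ u v)) (λ u v → to (nonedge⇔ u v)) k t)
    (shape-map (λ u v → Edge G (fn ι u) (fn ι v)) (λ u v → ¬ Edge G (fn ι u) (fn ι v))
      (Edge H) (λ u v → ¬ Edge H u v)
      id (λ u v → from (edge⇔ u v)) (λ u v → from (nonedge⇔ u v)) k t)

  leq⇔ : ∀ t u → Leq H t u ⇔ Leq G (map₃ (fn ι) t) (map₃ (fn ι) u)
  leq⇔ t u = edge⇔ (snd₃ t) (trd₃ u)

  step⇔ : ∀ t u → Step H t u ⇔ Step G (map₃ (fn ι) t) (map₃ (fn ι) u)
  step⇔ t u = edge⇔ (trd₃ t) (fst₃ u)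

  memb⇔ : ∀ t u → Memb H t u ⇔ Memb G (map₃ (fn ι) t) (map₃ (fn ι) u)
  memb⇔ t u = mk⇔ (λ (p , q) → to m p , to n q) (λ (p , q) → from m p , from n q)
    where
    m = edge⇔ (fst₃ t) (snd₃ u)
    n = nonedge⇔ (snd₃ u) (trd₃ t)

  model⇔ : ∀ k {M} e → Model H k M e ⇔ Model G (map₃ (fn ι) k) M (map₃ (fn ι) ∘ e)
  model⇔ k {M} e = mk⇔ push pull
    where
    push : Model H k M e → Model G (map₃ (fn ι) k) M (map₃ (fn ι) ∘ e)
    push m = record
      { segment = record
        { number = λ {i} i≤ → to (isNumber⇔ k (e i)) (number s i≤)
        ; leq⇔≤ = λ {i} {j} i≤ j≤ → let q = leq⇔ (e i) (e j) ; r = leq⇔≤ s i≤ j≤ in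
            mk⇔ (to r ∘ from q) (to q ∘ from r)
        ; step = λ {i} i< → to (step⇔ (e i) (e (suc i))) (step s i<)
        }
      ; bits = λ {i} {j} i≤ j≤ → let q = memb⇔ (e i) (e j) ; r = bits m i≤ j≤ in
          mk⇔ (to r ∘ from q) (to q ∘ from r)
      }
      where s = segment m
    pull : Model G (map₃ (fn ι) k) M (map₃ (fn ι) ∘ e) → Model H k M e
    pull m = record
      { segment = record
        { number = λ {i} i≤ → from (isNumber⇔ k (e i)) (number s i≤)
        ; leq⇔≤ = λ {i} {j} i≤ j≤ → let q = leq⇔ (e i) (e j) ; r = leq⇔≤ s i≤ j≤ in
            mk⇔ (to r ∘ to q) (from q ∘ from r)
        ; step = λ {i} i< → from (step⇔ (e i) (e (suc i))) (step s i<)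
        }
      ; bits = λ {i} {j} i≤ j≤ → let q = memb⇔ (e i) (e j) ; r = bits m i≤ j≤ in
          mk⇔ (to r ∘ to q) (from q ∘ from r)
      }
      where s = segment m

model-cong : ∀ {G k M e e'} → (∀ {i} → i ≤ M → e i ≡ e' i) → Model G k M e → Model G k M e'
model-cong {G} {k} e≡ m = record
  { segment = record
    { number = λ i≤ → subst (IsNumber G k) (e≡ i≤) (number s i≤)
    ; leq⇔≤ = λ {i} {j} i≤ j≤ → subst₂ (λ t u → Leq G t u ⇔ i ≤ j) (e≡ i≤) (e≡ j≤) (leq⇔≤ s i≤ j≤)
    ; step = λ i< → subst₂ (Step G) (e≡ (ℕₚ.<⇒≤ i<)) (e≡ i<) (step s i<)
    }
  ; bits = λ {i} {j} i≤ j≤ → subst₂ (λ t u → Memb G t u ⇔ Bit i j) (e≡ i≤) (e≡ j≤) (bits m i≤ j≤)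
  }
  where s = segment m

-- The bits of a number do not depend on M, so models can be cut off at any point.
model-≤ : ∀ {G k M M' e} → M' ≤ M → Model G k M e → Model G k M' e
model-≤ M'≤M m = record
  { segment = record
    { number = λ i≤ → number s (ℕₚ.≤-trans i≤ M'≤M)
    ; leq⇔≤ = λ i≤ j≤ → leq⇔≤ s (ℕₚ.≤-trans i≤ M'≤M) (ℕₚ.≤-trans j≤ M'≤M)
    ; step = λ i< → step s (ℕₚ.≤-trans i< M'≤M)
    }
  ; bits = λ i≤ j≤ → bits m (ℕₚ.≤-trans i≤ M'≤M) (ℕₚ.≤-trans j≤ M'≤M)
  }
  where s = segment m

components : ∀ {A} → Triple A → List A
components ⟨ x , y , z ⟩ = x ∷ y ∷ z ∷ []

segmentVertices : ∀ {A} → ℕ → (ℕ → Triple A) → List A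
segmentVertices zero    e = components (e 0)
segmentVertices (suc M) e = components (e (suc M)) List.++ segmentVertices M e

length-segmentVertices : ∀ {A} M (e : ℕ → Triple A) → length (segmentVertices M e) ≡ 3 + M * 3
length-segmentVertices zero    e = refl
length-segmentVertices (suc M) e = cong (3 +_) (length-segmentVertices M e)

components⊆segmentVertices : ∀ {A} M (e : ℕ → Triple A) {i} → i ≤ M →
                             ∀ {v} → v ∈ components (e i) → v ∈ segmentVertices M e
components⊆segmentVertices zero    e z≤n p = p
components⊆segmentVertices (suc M) e i≤ p with ℕₚ.m≤n⇒m<n∨m≡n i≤
... | inj₁ (s≤s i≤M) = ∈-++⁺ʳ (components (e (suc M))) (components⊆segmentVertices M e i≤M p)
... | inj₂ refl      = ∈-++⁺ˡ p

lift₃ : ∀ {H G} (ι : H ↪ G) t → components t CoveredBy ι → ∃ λ t' → map₃ (fn ι) t' ≡ t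
lift₃ ι ⟨ x , y , z ⟩ c with c (here refl) | c (there (here refl)) | c (there (there (here refl)))
... | x' , refl | y' , refl | z' , refl = ⟨ x' , y' , z' ⟩ , refl

modelVertices : ∀ {A} → Triple A → ℕ → (ℕ → Triple A) → List A
modelVertices k M e = components k List.++ segmentVertices M e

model-covered : ∀ {H G k M e} (ι : H ↪ G) → modelVertices k M e CoveredBy ι →
                Model G k M e → ∃₂ λ k' e' → Model H k' M e'
model-covered {H} {G} {k} {M} {e} ι c m =
  let k' , k≡ = lift₃ ι k (c ∘ ∈-++⁺ˡ)
  in k' , e' , from (model⇔ ι k' e')
       (subst (λ k → Model G k M (map₃ (fn ι) ∘ e')) (sym k≡) (model-cong (sym ∘ e≡) m))
  where
  lift : ∀ i → i ≤ M → ∃ λ t → map₃ (fn ι) t ≡ e i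
  lift i i≤ = lift₃ ι (e i) (c ∘ ∈-++⁺ʳ (components k) ∘ components⊆segmentVertices M e i≤)
  e' : ℕ → Triple (Vertex H)
  -- Beyond M the last value is repeated, as only indices up to M are known to have preimages.
  e' i = proj₁ (lift (i ⊓ M) (ℕₚ.m⊓n≤n i M))
  e≡ : ∀ {i} → i ≤ M → map₃ (fn ι) (e' i) ≡ e i
  e≡ {i} i≤ = trans (proj₂ (lift (i ⊓ M) (ℕₚ.m⊓n≤n i M))) (cong e (ℕₚ.m≤n⇒m⊓n≡m i≤))

-- Ordered graphs without a model of ψ.

modelFree : Arith 0 → Sentence
modelFree ψ = orderAxioms ∧' ¬' (hasModel ψ)

ordered-hereditary : HereditaryClass Ordered
ordered-hereditary {H} {G} ι o = orderAxioms⇒Ordered {H}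
  (univ-hereditary ι {orderAxioms} orderAxioms-univ {[]} {[]} (along λ ()) (Ordered⇒orderAxioms {G} o))

-- A model in H is mapped to one in G with the same M, hence with the same truth value of ψ, and
-- `hasModel` recognizes it because G is ordered.
modelFree-hereditary : ∀ ψ → HereditaryClass (_⊨ modelFree ψ)
modelFree-hereditary ψ {H} {G} ι (ax , ¬m) = Ordered⇒orderAxioms {H} oH , λ h →
  let k , M , e , m , s = to (hasModel⇔ModelOf ψ oH) h
  in ¬m (from (hasModel⇔ModelOf ψ oG)
       (map₃ (fn ι) k , M , map₃ (fn ι) ∘ e , to (model⇔ ι k e) m , s))
  where
  oG : Ordered G
  oG = orderAxioms⇒Ordered {G} ax
  oH : Ordered H
  oH = ordered-hereditary ι oG

modelFree-trivial : ∀ ψ G → size G ≡ 0 → G ⊨ modelFree ψ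
modelFree-trivial ψ G e = (⊥-elim ∘ absurd) , absurd ∘ proj₁
  where
  absurd : Vertex G → ⊥
  absurd v with () ← subst Fin e v

¬modelFree⇒ModelOf : ∀ {G} ψ → Ordered G → ¬ G ⊨ modelFree ψ → ModelOf ψ G
¬modelFree⇒ModelOf {G} ψ o ¬s = to (hasModel⇔ModelOf ψ o)
  (decidable-stable (sat? G (hasModel ψ) []) λ ¬h → ¬s (Ordered⇒orderAxioms {G} o , ¬h))

module _ {ψ : Arith 0} {M₀ : ℕ} (holds : Semantics.Holds Bit M₀ ψ [])
         {B : ℕ} (len≤B : len orderAxioms ≤ B) (size≤B : 6 + M₀ * 3 ≤ B) where

  -- A model with M ≤ M₀ is its own witness, and a longer one is cut off at M₀, where ψ is known to
  -- hold. Three parameters and three vertices for each of 0, ..., M₀ make 6 + 3 M₀.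
  modelFree-refutation : ∀ G → ¬ G ⊨ modelFree ψ →
    ∃ λ L → length L ≤ B × Refutes (modelFree ψ) G [] L
  modelFree-refutation G ¬s = decide (sat? G orderAxioms [])
    where
    Refutation : Set
    Refutation = ∃ λ L → length L ≤ B × Refutes (modelFree ψ) G [] L
    refute : ∀ {k M e} → M ≤ M₀ → Model G k M e → Semantics.Holds Bit M ψ [] → Refutation
    refute {k} {M} {e} M≤ m h = modelVertices k M e , l , r
      where
      l : length (modelVertices k M e) ≤ B
      l = ℕₚ.≤-trans (ℕₚ.≤-reflexive (cong (3 +_) (length-segmentVertices M e)))
            (ℕₚ.≤-trans (ℕₚ.+-monoʳ-≤ 6 (ℕₚ.*-monoˡ-≤ 3 M≤)) size≤B)
      r : Refutes (modelFree ψ) G [] (modelVertices k M e)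
      r {H} ι c {[]} _ (axH , ¬h) =
        let k' , e' , m' = model-covered ι c m
        in ¬h (from (hasModel⇔ModelOf ψ (orderAxioms⇒Ordered {H} axH)) (k' , M , e' , m' , h))
    shrink : ModelOf ψ G → Refutation
    shrink (k , M , e , m , h) with M ℕ.≤? M₀
    ... | yes M≤ = refute M≤ m h
    ... | no  M≰ = refute ℕₚ.≤-refl (model-≤ (ℕₚ.<⇒≤ (ℕₚ.≰⇒> M≰)) m) holds
    decide : Dec (G ⊨ orderAxioms) → Refutation
    decide (yes ax) = shrink (¬modelFree⇒ModelOf ψ (orderAxioms⇒Ordered {G} ax) ¬s)
    decide (no ¬ax) =
      let L , l , r = univ-refutation orderAxioms-univ G [] ¬ax
      in L , ℕₚ.≤-trans l len≤B , λ ι c {σ} p s → r ι c {σ} p (proj₁ s)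


-- The coding graphs.

Sort : Set
Sort = Fin 6

-- Constant links are kept apart from those that depend on the indices, so that sorts can be
-- identified without looking at indices.
data Link : Set where
  absent present : Link
  by             : (ℕ → ℕ → Bool) → Link

⟦_⟧ : Link → ℕ → ℕ → Bool
⟦ absent ⟧  _ _ = false
⟦ present ⟧ _ _ = true
⟦ by r ⟧    i j = r i j

-- The sorts 0, 1, 2 are those of the three components of a number, and 3, 4, 5 those of the
-- parameters.  Edges between components run forward (i ≤ j) along each of the three links,
-- so that a triangle has a single index.
half : Sort → Sort → Link
half 0F 1F = by λ i j → (i ≡ᵇ j) ∨ digit (digits j) i
half 1F 2F = by _≤ᵇ_
half 2F 0F = by λ i j → (i ≡ᵇ j) ∨ (suc i ≡ᵇ j)
half 0F 4F = present
half 0F 5F = present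
half 1F 3F = present
half 2F 3F = present
half 2F 4F = present
half 2F 5F = present
half 4F 5F = present
half _  _  = absent

link : Sort → Sort → ℕ → ℕ → Bool
link s s' i j = ⟦ half s s' ⟧ i j ∨ ⟦ half s' s ⟧ j i

-- An overapproximation of the values of `link s s'` that forgets the indices and leaves a finite
-- problem.
possible : Sort → Sort → Bool → Bool
possible s s' = either (half s s') (half s' s)
  where
  either : Link → Link → Bool → Bool
  either absent  absent  b = not b
  either present _       b = b
  either _       present b = b
  either _       _       b = true

possible-link : ∀ s s' i j → T (possible s s' (link s s' i j))
possible-link s s' i j with half s s' | half s' s
... | absent  | absent  = tt
... | absent  | present = tt
... | absent  | by _    = tt
... | present | _       = tt
... | by r    | absent  = tt
... | by r    | by _    = tt
... | by r    | present with r i j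
...   | true  = tt
...   | false = tt

abstract
  -- Decided by running through the sorts of all six vertices. Hypotheses stand between the
  -- quantifiers so that the search is cut off early.
  intended-sorts : ∀ a b → T (possible a b true) → ∀ c → T (possible b c true) → T (possible c a true) →
    ∀ k₁ → T (possible a k₁ true) → T (possible b k₁ false) → T (possible c k₁ true) →
    ∀ k₂ → T (possible a k₂ true) → T (possible b k₂ false) → T (possible c k₂ true) →
           T (possible k₁ k₂ true) →
    ∀ k₀ → T (possible a k₀ false) → T (possible b k₀ true) → T (possible c k₀ true) →
           T (possible k₀ k₁ false) → T (possible k₀ k₂ false) →
    a ≡ 0F × b ≡ 1F × c ≡ 2F
  intended-sorts = from-yes
    (all? λ a → all? λ b → P? a b true →-dec all? λ c → P? b c true →-dec P? c a true →-dec
     all? λ k₁ → P? a k₁ true →-dec P? b k₁ false →-dec P? c k₁ true →-dec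
     all? λ k₂ → P? a k₂ true →-dec P? b k₂ false →-dec P? c k₂ true →-dec P? k₁ k₂ true →-dec
     all? λ k₀ → P? a k₀ false →-dec P? b k₀ true →-dec P? c k₀ true →-dec
                 P? k₀ k₁ false →-dec P? k₀ k₂ false →-dec
     a Finₚ.≟ 0F ×-dec b Finₚ.≟ 1F ×-dec c Finₚ.≟ 2F)
    where
    open Finₚ using (all?)
    P? : ∀ s s' b → Dec (T (possible s s' b))
    P? s s' b = T? (possible s s' b)

no-loops : ∀ s i → link s s i i ≡ false
no-loops 0F i = refl
no-loops 1F i = refl
no-loops 2F i = refl
no-loops 3F i = refl
no-loops 4F i = refl
no-loops 5F i = refl

left-or-neither : ∀ {P : Set} {b} → (T b ⇔ P) → T (b ∨ false) ⇔ P
left-or-neither {b = b} e rewrite ∨-identityʳ b = e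

≡ᵇ⇔≡ : ∀ i j → T (i ≡ᵇ j) ⇔ i ≡ j
≡ᵇ⇔≡ i j = mk⇔ (ℕₚ.≡ᵇ⇒≡ i j) (ℕₚ.≡⇒≡ᵇ i j)

T-∨-cong : ∀ {P Q : Set} {b c} → (T b ⇔ P) → (T c ⇔ Q) → T (b ∨ c) ⇔ (P ⊎ Q)
T-∨-cong p q = mk⇔ (Sum.map (to p) (to q) ∘ to T-∨) (from T-∨ ∘ Sum.map (from p) (from q))

member-link : ∀ i j → T (link 0F 1F i j) ⇔ (i ≡ j ⊎ Bit i j)
member-link i j = left-or-neither (T-∨-cong (≡ᵇ⇔≡ i j) (mk⇔ id id))

order-link : ∀ i j → T (link 1F 2F i j) ⇔ i ≤ j
order-link i j = left-or-neither (mk⇔ (ℕₚ.≤ᵇ⇒≤ i j) ℕₚ.≤⇒≤ᵇ)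

step-link : ∀ i j → T (link 2F 0F i j) ⇔ (i ≡ j ⊎ suc i ≡ j)
step-link i j = left-or-neither (T-∨-cong (≡ᵇ⇔≡ i j) (≡ᵇ⇔≡ (suc i) j))

module Coding (M : ℕ) where

  Index : Set
  Index = Fin (suc M)

  abstract
    place : Fin (6 * suc M) → Sort × Index
    place = Fin.remQuot {6} (suc M)

    vertex : Sort → Index → Fin (6 * suc M)
    vertex = Fin.combine

    place-vertex : ∀ s i → place (vertex s i) ≡ (s , i)
    place-vertex = Finₚ.remQuot-combine

    vertex-place : ∀ u → vertex (proj₁ (place u)) (proj₂ (place u)) ≡ u
    vertex-place = Finₚ.combine-remQuot {6} (suc M)

  linkAt : Sort × Index → Sort × Index → Bool
  linkAt (s , i) (s' , j) = link s s' (toℕ i) (toℕ j)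

  codingGraph : FinGraph
  codingGraph = record
    { size   = 6 * suc M
    ; adj    = λ u v → linkAt (place u) (place v)
    ; irrefl = λ u → no-loops (proj₁ (place u)) _
    ; sym    = λ u v → ∨-comm (⟦ half (proj₁ (place u)) (proj₁ (place v)) ⟧ _ _) _
    }

  private
    G = codingGraph

  edge-vertex : ∀ s i s' j → Edge G (vertex s i) (vertex s' j) ≡ T (link s s' (toℕ i) (toℕ j))
  edge-vertex s i s' j =
    cong₂ (λ u v → T (linkAt u v)) (place-vertex s i) (place-vertex s' j)

  num : Index → Triple (Vertex G)
  num i = ⟨ vertex 0F i , vertex 1F i , vertex 2F i ⟩

  leq-num : ∀ i j → Leq G (num i) (num j) ⇔ toℕ i ≤ toℕ j
  leq-num i j rewrite edge-vertex 1F i 2F j = order-link (toℕ i) (toℕ j)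

  step-num : ∀ i j → Step G (num i) (num j) ⇔ (toℕ i ≡ toℕ j ⊎ suc (toℕ i) ≡ toℕ j)
  step-num i j rewrite edge-vertex 2F i 0F j = step-link (toℕ i) (toℕ j)

  memb-num : ∀ i j → Memb G (num i) (num j) ⇔ Bit (toℕ i) (toℕ j)
  memb-num i j rewrite edge-vertex 0F i 1F j = mk⇔
    (λ (m , ¬l) → Sum.[ (λ e → ⊥-elim (¬l (from (leq-num j i) (ℕₚ.≤-reflexive (sym e))))) , id ]
                    (to (member-link (toℕ i) (toℕ j)) m))
    (λ b → from (member-link (toℕ i) (toℕ j)) (inj₂ b) ,
           λ l → ℕₚ.<⇒≱ (Bit⇒< b) (to (leq-num j i) l))

  sort : Vertex G → Sort
  sort = proj₁ ∘ place

  index : Vertex G → Index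
  index = proj₂ ∘ place

  edge-possible : ∀ u v → Edge G u v → T (possible (sort u) (sort v) true)
  edge-possible u v e
    with link (sort u) (sort v) (toℕ (index u)) (toℕ (index v))
       | possible-link (sort u) (sort v) (toℕ (index u)) (toℕ (index v))
  ... | true | p = p

  nonedge-possible : ∀ u v → ¬ Edge G u v → T (possible (sort u) (sort v) false)
  nonedge-possible u v n
    with link (sort u) (sort v) (toℕ (index u)) (toℕ (index v))
       | possible-link (sort u) (sort v) (toℕ (index u)) (toℕ (index v))
  ... | false | p = p
  ... | true  | p = ⊥-elim (n tt)

  at-vertex : ∀ u {s} → sort u ≡ s → u ≡ vertex s (index u)
  at-vertex u refl = sym (vertex-place u)

  -- `intended-sorts` fixes the sorts, whatever the parameters are; the triangle then gives i ≤ j ≤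
  -- l ≤ i for the indices.
  number⇒num : ∀ k t → IsNumber G k t → ∃ λ i → t ≡ num i
  number⇒num ⟨ k₀ , k₁ , k₂ ⟩ ⟨ a , b , c ⟩
    (ab , bc , ca , ak₁ , ak₂ , bk₀ , ck₀ , ck₁ , ck₂ , k₁k₂ , ak₀ , bk₁ , bk₂ , k₀k₁ , k₀k₂) =
    same-index (index a) (index b) (index c)
      (at-vertex a (proj₁ sorts)) (at-vertex b (proj₁ (proj₂ sorts)))
      (at-vertex c (proj₂ (proj₂ sorts)))
    where
    sorts : sort a ≡ 0F × sort b ≡ 1F × sort c ≡ 2F
    sorts = intended-sorts
      (sort a) (sort b) (edge-possible a b ab)
      (sort c) (edge-possible b c bc) (edge-possible c a ca)
      (sort k₁) (edge-possible a k₁ ak₁) (nonedge-possible b k₁ bk₁) (edge-possible c k₁ ck₁)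
      (sort k₂) (edge-possible a k₂ ak₂) (nonedge-possible b k₂ bk₂) (edge-possible c k₂ ck₂)
                (edge-possible k₁ k₂ k₁k₂)
      (sort k₀) (nonedge-possible a k₀ ak₀) (edge-possible b k₀ bk₀) (edge-possible c k₀ ck₀)
                (nonedge-possible k₀ k₁ k₀k₁) (nonedge-possible k₀ k₂ k₀k₂)
    same-index : ∀ i j l → a ≡ vertex 0F i → b ≡ vertex 1F j → c ≡ vertex 2F l →
                 ∃ λ i → ⟨ a , b , c ⟩ ≡ num i
    same-index i j l refl refl refl =
      i , cong₂ ⟨ vertex 0F i ,_,_⟩ (cong (vertex 1F) (sym i≡j)) (cong (vertex 2F) (sym i≡l))
      where
      i≤j : toℕ i ≤ toℕ j
      i≤j with to (member-link (toℕ i) (toℕ j)) (subst id (edge-vertex 0F i 1F j) ab)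
      ... | inj₁ e = ℕₚ.≤-reflexive e
      ... | inj₂ m = ℕₚ.<⇒≤ (Bit⇒< m)
      j≤l : toℕ j ≤ toℕ l
      j≤l = to (order-link (toℕ j) (toℕ l)) (subst id (edge-vertex 1F j 2F l) bc)
      l≤i : toℕ l ≤ toℕ i
      l≤i with to (step-link (toℕ l) (toℕ i)) (subst id (edge-vertex 2F l 0F i) ca)
      ... | inj₁ e = ℕₚ.≤-reflexive e
      ... | inj₂ e = ℕₚ.<⇒≤ (ℕₚ.≤-reflexive e)
      i≡j : i ≡ j
      i≡j = Finₚ.toℕ-injective (ℕₚ.≤-antisym i≤j (ℕₚ.≤-trans j≤l l≤i))
      i≡l : i ≡ l
      i≡l = Finₚ.toℕ-injective (ℕₚ.≤-antisym (ℕₚ.≤-trans i≤j j≤l) l≤i)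

  num-good : ∀ i j l → ¬ Bad G (num i) (num j) (num l)
  num-good i j l (inj₁ (i≰j , j≰i)) = Sum.[ i≰j ∘ from (leq-num i j) , j≰i ∘ from (leq-num j i) ]
    (ℕₚ.≤-total (toℕ i) (toℕ j))
  num-good i j l (inj₂ (inj₁ (i≤j , j≤l , i≰l))) =
    i≰l (from (leq-num i l) (ℕₚ.≤-trans (to (leq-num i j) i≤j) (to (leq-num j l) j≤l)))
  num-good i j l (inj₂ (inj₂ (inj₁ (i≤j , j≤i , ≢)))) =
    ≢ (cong (vertex 0F) i≡j , cong (vertex 1F) i≡j , cong (vertex 2F) i≡j)
    where
    i≡j : i ≡ j
    i≡j = Finₚ.toℕ-injective (ℕₚ.≤-antisym (to (leq-num i j) i≤j) (to (leq-num j i) j≤i))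
  num-good i j l (inj₂ (inj₂ (inj₂ (s , i≤l , l≤j , l≰i , j≰l)))) = between (to (step-num i j) s)
    where
    between : ¬ (toℕ i ≡ toℕ j ⊎ suc (toℕ i) ≡ toℕ j)
    between (inj₁ i≡j)   = l≰i (from (leq-num l i) (subst (toℕ l ≤_) (sym i≡j) (to (leq-num l j) l≤j)))
    between (inj₂ 1+i≡j) = j≰l (from (leq-num j l) (subst (_≤ toℕ l) 1+i≡j
                             (ℕₚ.≰⇒> (l≰i ∘ from (leq-num l i)))))

  coding-ordered : Ordered G
  coding-ordered k x y z (nx , ny , nz , bad) =
    good (number⇒num k x nx) (number⇒num k y ny) (number⇒num k z nz) bad
    where
    good : ∀ {x y z} → (∃ λ i → x ≡ num i) → (∃ λ i → y ≡ num i) → (∃ λ i → z ≡ num i) →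
           ¬ Bad G x y z
    good (i , refl) (j , refl) (l , refl) = num-good i j l

  clamp : ℕ → Index
  clamp i = Fin.fromℕ< (s≤s (ℕₚ.m⊓n≤n i M))

  toℕ-clamp : ∀ {i} → i ≤ M → toℕ (clamp i) ≡ i
  toℕ-clamp i≤M = trans (Finₚ.toℕ-fromℕ< _) (ℕₚ.m≤n⇒m⊓n≡m i≤M)

  parameters : Triple (Vertex G)
  -- Vertices of one parameter sort all have the same neighbours, so index 0 is an arbitrary choice.
  parameters = ⟨ vertex 3F zero , vertex 4F zero , vertex 5F zero ⟩

  num-number : ∀ i → IsNumber G parameters (num i)
  num-number i =
    edge (from (member-link (toℕ i) (toℕ i)) (inj₁ refl)) ,
    edge (from (order-link (toℕ i) (toℕ i)) ℕₚ.≤-refl) ,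
    edge (from (step-link (toℕ i) (toℕ i)) (inj₁ refl)) ,
    edge tt , edge tt , edge tt , edge tt , edge tt , edge tt , edge tt ,
    nonedge id , nonedge id , nonedge id , nonedge id , nonedge id
    where
    edge : ∀ {s i s' j} → T (link s s' (toℕ i) (toℕ j)) → Edge G (vertex s i) (vertex s' j)
    edge {s} {i} {s'} {j} = subst id (sym (edge-vertex s i s' j))
    nonedge : ∀ {s s' i j} → ¬ T (link s s' (toℕ i) (toℕ j)) → ¬ Edge G (vertex s i) (vertex s' j)
    nonedge {s} {s'} {i} {j} n = n ∘ subst id (edge-vertex s i s' j)

  coding-model : Model G parameters M (num ∘ clamp)
  coding-model = record
    { segment = record
      { number = λ _ → num-number _
      ; leq⇔≤ = λ {i} {j} i≤ j≤ → subst₂ (λ x y → Leq G (num (clamp i)) (num (clamp j)) ⇔ x ≤ y)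
          (toℕ-clamp i≤) (toℕ-clamp j≤) (leq-num (clamp i) (clamp j))
      ; step = λ {i} i< → from (step-num (clamp i) (clamp (suc i)))
          (inj₂ (trans (cong suc (toℕ-clamp (ℕₚ.<⇒≤ i<))) (sym (toℕ-clamp i<))))
      }
    ; bits = λ {i} {j} i≤ j≤ → subst₂ (λ x y → Memb G (num (clamp i)) (num (clamp j)) ⇔ Bit x y)
        (toℕ-clamp i≤) (toℕ-clamp j≤) (memb-num (clamp i) (clamp j))
    }


-- Lengths of the sentences, padding and growth of towers.

existsLength : ℕ
existsLength = 9 + len (inSegmentF (mapFrame (Fin._↑ʳ_ 3) outerFrame) newest)

-- All atoms have length 3, so neither frame nor variables matter. The 10 of `mem` is two atoms, a
-- conjunction and a negation; `all` exceeds `ex` by the negated guard.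
arithLength : ∀ {m} → Arith m → ℕ
arithLength (le x y)   = 3
arithLength (mem x y)  = 10
arithLength (neg ψ)    = suc (arithLength ψ)
arithLength (conj ψ χ) = 3 + arithLength ψ + arithLength χ
arithLength (alt ψ χ)  = 3 + arithLength ψ + arithLength χ
arithLength (all ψ)    = suc existsLength + arithLength ψ
arithLength (ex ψ)     = existsLength + arithLength ψ

len-interpret : ∀ {m n} (F : Frame (Fin n)) σ (ψ : Arith m) →
                len (interpret F σ ψ) ≡ arithLength ψ
len-interpret F σ (le x y)   = refl
len-interpret F σ (mem x y)  = refl
len-interpret F σ (neg ψ)    = cong suc (len-interpret F σ ψ)
len-interpret F σ (conj ψ χ) = cong₂ (λ a b → 3 + a + b) (len-interpret F σ ψ) (len-interpret F σ χ)
len-interpret F σ (alt ψ χ)  = cong₂ (λ a b → 3 + a + b) (len-interpret F σ ψ) (len-interpret F σ χ)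
len-interpret F σ (all ψ)    = cong (suc existsLength +_) (len-interpret _ _ ψ)
len-interpret F σ (ex ψ)     = cong (existsLength +_) (len-interpret _ _ ψ)

Linear : (ℕ → ℕ) → Set
Linear g = ∃₂ λ a b → ∀ j → g j ≡ a + j * b

linear-shift : ∀ a {g} b → Linear g → Linear (λ j → a + g j + b)
linear-shift a b (c , d , e) = a + c + b , d , λ j → trans (cong (λ x → a + x + b) (e j))
  (solve 4 (λ a b c x → a :+ (c :+ x) :+ b := a :+ c :+ b :+ x) refl a b c (j * d))
  where open +-*-Solver

-- Length does not depend on the variable, so each level adds the same `slope`.
tower-linear : ∀ {m} (x : Fin m) → Linear (λ j → arithLength (tower j x))
tower-linear {m} x = base , slope , λ j → go j x
  where
  base slope rest : ℕ
  base  = arithLength (isZero {1} 0F)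
  rest  = arithLength (mem {2} 0F 1F & all (alt (neg (mem 1F 0F)) (le 2F 0F)))
  slope = existsLength + 3 + rest
  go : ∀ {m} j (x : Fin m) → arithLength (tower j x) ≡ base + j * slope
  go zero    x = refl
  go {m} (suc j) x = begin
    arithLength (tower (suc j) x)             ≡⟨⟩
    next (arithLength (tower {suc m} j 0F))   ≡⟨ cong next {arithLength (tower {suc m} j 0F)} ih ⟩
    next (base + j * slope)                   ≡⟨ rearrange existsLength base rest (j * slope) ⟩
    base + (slope + j * slope)                ∎
    where
    open ≡-Reasoning
    ih : arithLength (tower {suc m} j 0F) ≡ base + j * slope
    ih = go {suc m} j 0F
    next : ℕ → ℕ
    next l = existsLength + (3 + l + rest)
    rearrange : ∀ e b r s → e + (3 + (b + s) + r) ≡ b + ((e + 3 + r) + s)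
    rearrange = solve 4 (λ e b r s →
      e :+ (con 3 :+ (b :+ s) :+ r) := b :+ ((e :+ con 3 :+ r) :+ s)) refl
      where open +-*-Solver

linear-+ : ∀ a {g} → Linear g → Linear (λ j → a + g j)
linear-+ a (c , d , e) = a + c , d , λ j → trans (cong (a +_) (e j)) (sym (ℕₚ.+-assoc a c (j * d)))

len-modelFree : ∃ λ a → ∀ ψ → len (modelFree ψ) ≡ a + arithLength ψ
len-modelFree = a , λ ψ → begin
  len (modelFree ψ)                                   ≡⟨⟩
  context (len (interpret outerFrame noTriples ψ))    ≡⟨ cong context (len-interpret _ _ ψ) ⟩
  context (arithLength ψ)                             ≡⟨ rearrange o n n' s r (arithLength ψ) ⟩
  a + arithLength ψ                                   ∎
  where
  open ≡-Reasoning
  o n n' s r a : ℕ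
  o  = len orderAxioms
  n  = len (numberF (params outerFrame) (lower outerFrame))
  n' = len (numberF (params outerFrame) (upper outerFrame))
  s  = len (connectedF outerFrame)
  r  = len (interpret outerFrame noTriples bitRule)
  -- The 40 is 18 for nine quantifiers, 18 for six conjunctions, 3 for `leqF` and 1 for the
  -- negation.
  a  = 40 + o + n + n' + s + r
  context : ℕ → ℕ
  context x = 3 + o + suc (18 + (3 + n + (3 + n' + (6 + (3 + s + (3 + r + x))))))
  rearrange : ∀ o n n' s r x →
    3 + o + suc (18 + (3 + n + (3 + n' + (6 + (3 + s + (3 + r + x)))))) ≡ 40 + o + n + n' + s + r + x
  rearrange = solve 6 (λ o n n' s r x →
    con 3 :+ o :+ (con 1 :+ (con 18 :+ (con 3 :+ n :+ (con 3 :+ n' :+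
      (con 6 :+ (con 3 :+ s :+ (con 3 :+ r :+ x)))))))
      := con 40 :+ o :+ n :+ n' :+ s :+ r :+ x) refl
    where open +-*-Solver

-- Double negation adds 2, so valid sentences of lengths 5 and 6 suffice to reach every length from
-- 5 on.
padding : ℕ → Sentence
padding zero          = ∀' (0F ≐ 0F)
padding (suc zero)    = ∀' (¬' (E 0F 0F))
padding (suc (suc n)) = ¬' (¬' (padding n))

len-padding : ∀ n → len (padding n) ≡ 5 + n
len-padding zero          = refl
len-padding (suc zero)    = refl
len-padding (suc (suc n)) = cong (2 +_) (len-padding n)

padding-valid : ∀ {G} n → G ⊨ padding n
padding-valid zero x              = refl
padding-valid {G} (suc zero) x e  = subst T (irrefl G x) e
padding-valid {G} (suc (suc n)) h = h (padding-valid {G} n)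

goal-linear : ∀ c → Linear (λ j → len (modelFree (goal c j)))
goal-linear c = prepend len-modelFree
  where
  goal-length : Linear (λ j → arithLength (goal c j))
  goal-length = linear-shift (existsLength + 3)
    (existsLength + arithLength (graph c (λ _ → 1F) 0F)) (tower-linear 0F)
  prepend : (∃ λ a → ∀ ψ → len (modelFree ψ) ≡ a + arithLength ψ) →
            Linear (λ j → len (modelFree (goal c j)))
  prepend (a , l) = let b , d , e = linear-+ a goal-length in b , d , λ j → trans (l (goal c j)) (e j)

j≤tow : ∀ j → j ≤ tow j
j≤tow zero    = z≤n
j≤tow (suc j) = ℕₚ.≤-trans (s≤s (j≤tow j)) (n<2^n (tow j))

-- For s = a + b and m = 3s, the left side at j = m + 1 is at most (s + 1)³ ≤ (2^s)³ = 2^m ≤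
-- 2^(`tow m`).
tow-superlinear : ∀ a b → ∃ λ j → a + j * b ≤ tow j
tow-superlinear a b = suc m , (begin
  a + suc m * b                        ≤⟨ ℕₚ.+-mono-≤ (ℕₚ.m≤m+n a b)
                                            (ℕₚ.*-monoʳ-≤ (suc m) (ℕₚ.m≤n+m b a)) ⟩
  s + suc m * s                        ≤⟨ ℕₚ.m≤m+n _ (1 + s + s * s * s) ⟩
  s + suc m * s + (1 + s + s * s * s)  ≡⟨ cube s ⟩
  suc s * (suc s * suc s)              ≤⟨ ℕₚ.*-mono-≤ (n<2^n s) (ℕₚ.*-mono-≤ (n<2^n s) (n<2^n s)) ⟩
  2 ^ s * (2 ^ s * 2 ^ s)              ≡⟨ cong (2 ^ s *_) (sym (ℕₚ.^-distribˡ-+-* 2 s s)) ⟩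
  2 ^ s * 2 ^ (s + s)                  ≡⟨ sym (ℕₚ.^-distribˡ-+-* 2 s (s + s)) ⟩
  2 ^ m                                ≤⟨ ℕₚ.^-monoʳ-≤ 2 (j≤tow m) ⟩
  2 ^ tow m                            ∎)
  where
  open ℕₚ.≤-Reasoning
  s = a + b
  m = s + (s + s)
  cube : ∀ s → s + suc (s + (s + s)) * s + (1 + s + s * s * s) ≡ suc s * (suc s * suc s)
  cube = solve 1 (λ s → s :+ (con 1 :+ (s :+ (s :+ s))) :* s :+ (con 1 :+ s :+ s :* s :* s)
                     := (con 1 :+ s) :* ((con 1 :+ s) :* (con 1 :+ s))) refl
    where open +-*-Solver

-- The 3 is for the conjunction with the padding, and 5 + n is the length of `padding n`.
calibrate : ∀ {g} → Linear g → ∃₂ λ j n → 3 + g j + (5 + n) ≡ tow j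
calibrate {g} (a , b , e) = pad (tow-superlinear (8 + a) b)
  where
  rearrange : ∀ x n → 3 + x + (5 + n) ≡ 8 + x + n
  rearrange = solve 2 (λ x n → con 3 :+ x :+ (con 5 :+ n) := con 8 :+ x :+ n) refl
    where open +-*-Solver
  pad : (∃ λ j → 8 + a + j * b ≤ tow j) → ∃₂ λ j n → 3 + g j + (5 + n) ≡ tow j
  pad (j , fits) = j , tow j ∸ (8 + a + j * b) ,
    trans (cong (λ x → 3 + x + (5 + (tow j ∸ (8 + a + j * b)))) (e j))
      (trans (rearrange (a + j * b) _) (ℕₚ.m+[n∸m]≡n fits))

-- The argument of f is described by a sentence whose length grows only linearly in j, so that
-- some sentence can be padded to have exactly that argument as its length.
exact-length : (φ : ℕ → Sentence) → Linear (λ j → len (φ j)) →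
               ∃₂ λ j n → len (φ j ∧' padding n) ≡ tow j
exact-length φ l = pad (calibrate l)
  where
  pad : (∃₂ λ j n → 3 + len (φ j) + (5 + n) ≡ tow j) → ∃₂ λ j n → len (φ j ∧' padding n) ≡ tow j
  pad (j , n , e) = j , n , trans (cong (3 + len (φ j) +_) (len-padding n)) e

-- The padded sentence and the length of its universal axiomatizations.

module _ {f : ℕ → ℕ} {c : PR 1} (computes : ∀ n → Eval c (n ∷ []) (f n)) where

  module Padded (j n : ℕ) where

    private
      ψ : Arith 0
      ψ = goal c j
      φ : Sentence
      φ = modelFree ψ ∧' padding n
      M : ℕ
      M = proj₁ (goal-complete {c} {j} (computes (tow j)))

    open Coding M

    ψ-holds : Semantics.Holds Bit M ψ []
    ψ-holds = proj₂ (goal-complete {c} {j} (computes (tow j)))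

    coding-violates : ¬ codingGraph ⊨ modelFree ψ
    coding-violates (_ , ¬model) =
      ¬model (from (hasModel⇔ModelOf ψ coding-ordered) (parameters , M , _ , coding-model , ψ-holds))

    -- As an induced subgraph of an ordered graph, H can fail only by containing a model of the
    -- goal; its M' is at least the value of f, and its segment occupies more than M' vertices.
    violators-large : ∀ {H} → H ↪ codingGraph → ¬ H ⊨ φ → f (tow j) ≤ size H
    violators-large {H} ι ¬s =
      let _ , M' , _ , model , h = ¬modelFree⇒ModelOf {H} ψ (ordered-hereditary ι coding-ordered)
                                     λ s → ¬s (s , padding-valid {H} n)
      in ℕₚ.≤-trans (goal-sound {c = c} {j} (computes (tow j)) h)
           (ℕₚ.≤-trans (ℕₚ.n≤1+n M') (segment-size (Model.segment model)))

    witnessBound : ℕ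
    witnessBound = len orderAxioms + (6 + M * 3)

    refutation : ∀ G → ¬ G ⊨ φ → ∃ λ L → List.length L ≤ suc witnessBound × Refutes φ G [] L
    refutation G ¬s =
      let L , l , r = modelFree-refutation {ψ} {M} ψ-holds {suc witnessBound}
                        (ℕₚ.m≤n⇒m≤1+n (ℕₚ.m≤m+n (len orderAxioms) (6 + M * 3)))
                        (ℕₚ.m≤n⇒m≤1+n (ℕₚ.m≤n+m (6 + M * 3) (len orderAxioms)))
                        G λ s → ¬s (s , padding-valid {G} n)
      in L , l , λ ι c {σ} p s → r ι c {σ} p (proj₁ s)

    universally-axiomatizable : Σ Sentence λ μ → IsUniversal μ × (_⊨ φ) ≡Graphfin μ
    universally-axiomatizable = Universal.universal-axiomatization φ
      (λ {H} {G} ι s → modelFree-hereditary ψ {H} {G} ι (proj₁ s) , padding-valid {H} n)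
      witnessBound refutation (λ G e → modelFree-trivial ψ G e , padding-valid {G} n)

    axiomatizations-long : ∀ μ → IsUniversal μ → (_⊨ φ) ≡Graphfin μ → f (tow j) ≤ len μ
    axiomatizations-long μ u same =
      universal-length {φ} u same codingGraph (coding-violates ∘ proj₁) violators-large

HardlyUniversal : (ℕ → ℕ) → Set₁
HardlyUniversal f =
  Σ (FinGraph → Set) λ C → Σ Sentence λ φ →
    (C ≡Graphfin φ)
    × Σ Sentence (λ μ → IsUniversal μ × C ≡Graphfin μ)
    × (∀ (μ : Sentence) → IsUniversal μ → C ≡Graphfin μ → len μ ≥ f (len φ))

-- Stated for a variable N in place of `tow j`, so that the equation for the length can be
-- eliminated.
hardlyUniversal : ∀ {f N} (φ : Sentence) → len φ ≡ N →
  Σ Sentence (λ μ → IsUniversal μ × (_⊨ φ) ≡Graphfin μ) →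
  (∀ μ → IsUniversal μ → (_⊨ φ) ≡Graphfin μ → f N ≤ len μ) → HardlyUniversal f
hardlyUniversal φ refl axiomatizable long = (_⊨ φ) , φ , (λ G → id , id) , axiomatizable , long

theorem1p4 : (f : ℕ → ℕ) → Computable f →
    Σ (FinGraph → Set) λ C → Σ Sentence λ φ →
    (C ≡Graphfin φ)
    × Σ Sentence (λ μ → IsUniversal μ × C ≡Graphfin μ)
    × (∀ (μ : Sentence) → IsUniversal μ → C ≡Graphfin μ → len μ ≥ f (len φ))
theorem1p4 f (c , computes) = conclude (exact-length (λ j → modelFree (goal c j)) (goal-linear c))
  where
  conclude : (∃₂ λ j n → len (modelFree (goal c j) ∧' padding n) ≡ tow j) → HardlyUniversal f
  conclude (j , n , e) = hardlyUniversal {f} (modelFree (goal c j) ∧' padding n) e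
    universally-axiomatizable axiomatizations-long
    where open Padded {f} {c} computes j n
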